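{- There are a computable function $f$ and an algorithm that, given a finite simple connected undirected graph $G$ with at least two vertices and a set $X\subseteq V(G)$ of size $d$ such that $G\setminus X$ is a threshold graph, runs in time $f(d)\cdot|V(G)|^{O(1)}$ and finds a conflict-free open neighborhood coloring of $G$ with $k$ colors, for some $k$ satisfying $\chi_{cf}(G)\le k\le \chi_{cf}(G)+2$.
   Context: A threshold graph is a graph that can be constructed recursively (starting from a single vertex) by repeatedly adding an isolated vertex or a universal vertex (a vertex adjacent to all other current vertices). $G\setminus X$ is the graph obtained from $G$ by deleting the vertices of $X$. Let $N(v)$ be the open neighborhood of $v$ (the set of vertices adjacent to $v$). For a coloring $C_G:V(G)\to\{1,\dots,k\}$ (not necessarily proper), a set $U\subseteq V(G)$ has a unique color if there is a color $c$ with $|\{u\in U: C_G(u)=c\}|=1$. The coloring is a conflict-free open neighborhood (CF-ON) coloring if $N(v)$ has a unique color for every $v\in V(G)$. $\chi_{cf}(G)$ denotes the minimum number of colors in a CF-ON coloring of $G$. -}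

module Defs where

open import Data.Bool.Base using (Bool; true; false)
open import Data.Fin.Base using (Fin; zero; suc; toℕ; punchIn)
open import Data.Fin.Properties using (_≟_)
open import Data.Fin.Subset using (Subset; inside; outside; ∣_∣; _∩_; ∁)
open import Data.List.Base using (List; []; _∷_)
open import Data.Nat.Base using (ℕ; zero; suc; _+_; _≤_)
open import Data.Product.Base using (Σ; ∃-syntax; _×_)
open import Data.Vec.Base using (Vec; []; _∷_; tabulate; toList)
open import Function.Base using (_∘_)
open import Relation.Binary.Construct.Closure.ReflexiveTransitive using (Star)
open import Relation.Binary.PropositionalEquality.Core using (_≡_; _≢_)
open import Relation.Nullary.Decidable.Core using (does)
open import Relation.Nullary.Negation.Core using (¬_)

------------------------------------------------------------------------
-- Finite simple graphs

record Graph (n : ℕ) : Set where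
  field
    adj    : Fin n → Fin n → Bool
    sym    : ∀ u v → adj u v ≡ adj v u
    irrefl : ∀ v → adj v v ≡ false

  Adj : Fin n → Fin n → Set
  Adj u v = adj u v ≡ true

  N : Fin n → Subset n
  N v = tabulate (adj v)

  Connected : Set
  Connected = ∀ u v → Star Adj u v

  Isolated : Fin n → Set
  Isolated v = ∀ u → ¬ Adj v u

  Universal : Fin n → Set
  Universal v = ∀ u → u ≢ v → Adj v u

open Graph public using (N; Connected; Isolated; Universal)

-- The i-th smallest element of S.
element : ∀ {n} (S : Subset n) → Fin ∣ S ∣ → Fin n
element (inside  ∷ S) zero    = zero
element (inside  ∷ S) (suc i) = suc (element S i)
element (outside ∷ S) i       = suc (element S i)

-- For injective ι, the subgraph of G induced by the image of ι.
pullback : ∀ {m n} → Graph n → (Fin m → Fin n) → Graph m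
pullback G ι = record
  { adj    = λ u v → Graph.adj G (ι u) (ι v)
  ; sym    = λ u v → Graph.sym G (ι u) (ι v)
  ; irrefl = λ v → Graph.irrefl G (ι v)
  }

infixl 6 _∖_ _∖ᵥ_

_∖_ : ∀ {n} → Graph n → (X : Subset n) → Graph ∣ ∁ X ∣
G ∖ X = pullback G (element (∁ X))

_∖ᵥ_ : ∀ {n} → Graph (suc n) → Fin (suc n) → Graph n
G ∖ᵥ v = pullback G (punchIn v)

-- "G arises from H by adding an isolated (universal) vertex" is expressed
-- as "G has an isolated (universal) vertex v with G ∖ᵥ v = H", so that v may
-- carry any label.  There is no threshold graph on zero vertices.
data Threshold : ∀ {n} → Graph n → Set where
  single       : (G : Graph 1) → Threshold G
  addIsolated  : ∀ {n} (G : Graph (suc n)) v →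
                 Isolated G v → Threshold (G ∖ᵥ v) → Threshold G
  addUniversal : ∀ {n} (G : Graph (suc n)) v →
                 Universal G v → Threshold (G ∖ᵥ v) → Threshold G

------------------------------------------------------------------------
-- Conflict-free open neighborhood colorings

Coloring : ℕ → ℕ → Set
Coloring n k = Fin n → Fin k

colorClass : ∀ {n k} → Coloring n k → Fin k → Subset n
colorClass C c = tabulate (λ u → does (C u ≟ c))

HasUniqueColor : ∀ {n k} → Coloring n k → Subset n → Set
HasUniqueColor C U = ∃[ c ] ∣ U ∩ colorClass C c ∣ ≡ 1

IsCFON : ∀ {n k} → Graph n → Coloring n k → Set
IsCFON G C = ∀ v → HasUniqueColor C (N G v)

CFONColorable : ∀ {n} → Graph n → ℕ → Set
CFONColorable {n} G k = Σ (Coloring n k) (IsCFON G)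

-- χ_cf(G) = χ.  A relation, because χ_cf(G) is undefined when G has an
-- isolated vertex.
χcf[_]≡_ : ∀ {n} → Graph n → ℕ → Set
χcf[ G ]≡ χ = CFONColorable G χ × (∀ k → CFONColorable G k → χ ≤ k)

------------------------------------------------------------------------
-- Model of computation
--
-- An expression-style variant of Jones' WHILE language over binary trees
-- (N. D. Jones, Computability and Complexity from a Programming Perspective):
-- a program maps a tree to a tree, and the current tree takes the place of
-- the store.  Each executed constructor costs one time unit, which is
-- constant time on a pointer machine, where  pair  allocates one cell whose
-- components may be shared.  The language is Turing complete, and its
-- running times agree with those of Turing machines up to a polynomial.

data Tree : Set where
  nil : Tree
  _∙_ : Tree → Tree → Tree

infixr 5 _∙_

data Prog : Set where
  idᵖ nilᵖ hd tl : Prog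
  pair           : Prog → Prog → Prog
  _⨟_            : Prog → Prog → Prog
  if_then_else_  : Prog → Prog → Prog → Prog
  while_run_     : Prog → Prog → Prog

infixr 5 _⨟_
infix  4 if_then_else_ while_run_

-- p ⊢ x ⇓ y [ t ]: on input x, program p halts with output y after exactly
-- t steps.  In tests, nil is false and every other tree is true.

infix 3 _⊢_⇓_[_]

data _⊢_⇓_[_] : Prog → Tree → Tree → ℕ → Set where

  ⇓id   : ∀ {x} → idᵖ ⊢ x ⇓ x [ 1 ]

  ⇓nil  : ∀ {x} → nilᵖ ⊢ x ⇓ nil [ 1 ]

  ⇓hd-∙   : ∀ {a b} → hd ⊢ a ∙ b ⇓ a [ 1 ]
  ⇓hd-nil : hd ⊢ nil ⇓ nil [ 1 ]

  ⇓tl-∙   : ∀ {a b} → tl ⊢ a ∙ b ⇓ b [ 1 ]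
  ⇓tl-nil : tl ⊢ nil ⇓ nil [ 1 ]

  ⇓pair : ∀ {p q x y z s t} →
          p ⊢ x ⇓ y [ s ] → q ⊢ x ⇓ z [ t ] →
          pair p q ⊢ x ⇓ y ∙ z [ suc (s + t) ]

  ⇓⨟    : ∀ {p q x y z s t} →
          p ⊢ x ⇓ y [ s ] → q ⊢ y ⇓ z [ t ] →
          p ⨟ q ⊢ x ⇓ z [ suc (s + t) ]

  ⇓then : ∀ {b p q x y u v s t} →
          b ⊢ x ⇓ u ∙ v [ s ] → p ⊢ x ⇓ y [ t ] →
          if b then p else q ⊢ x ⇓ y [ suc (s + t) ]

  ⇓else : ∀ {b p q x y s t} →
          b ⊢ x ⇓ nil [ s ] → q ⊢ x ⇓ y [ t ] →
          if b then p else q ⊢ x ⇓ y [ suc (s + t) ]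

  ⇓stop : ∀ {b p x s} →
          b ⊢ x ⇓ nil [ s ] →
          while b run p ⊢ x ⇓ x [ suc s ]

  ⇓loop : ∀ {b p x y z u v r s t} →
          b ⊢ x ⇓ u ∙ v [ r ] → p ⊢ x ⇓ y [ s ] →
          while b run p ⊢ y ⇓ z [ t ] →
          while b run p ⊢ x ⇓ z [ suc (r + s + t) ]

------------------------------------------------------------------------
-- Encodings

encList : ∀ {A : Set} → (A → Tree) → List A → Tree
encList enc []       = nil
encList enc (x ∷ xs) = enc x ∙ encList enc xs

encVec : ∀ {A : Set} {n} → (A → Tree) → Vec A n → Tree
encVec enc xs = encList enc (toList xs)

encBool : Bool → Tree
encBool false = nil
encBool true  = nil ∙ nil

-- Unary.
encℕ : ℕ → Tree
encℕ zero    = nil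
encℕ (suc n) = nil ∙ encℕ n

encSubset : ∀ {n} → Subset n → Tree
encSubset = encVec encBool

-- Adjacency matrix, row by row.
encGraph : ∀ {n} → Graph n → Tree
encGraph G = encVec encSubset (tabulate (N G))

encColoring : ∀ {n k} → Coloring n k → Tree
encColoring C = encVec encℕ (tabulate (toℕ ∘ C))

Computable : (ℕ → ℕ) → Set
Computable f = ∃[ p ] ∀ n → ∃[ t ] p ⊢ encℕ n ⇓ encℕ (f n) [ t ]

{-# OPTIONS --safe #-}

-- Let T = G ∖ X.  A threshold graph has a hub u: every other vertex of T is
-- adjacent to u or isolated in T.  Put Y = X ∪ {u}; a vertex outside Y is
-- adjacent to u or has all its neighbors in Y.  Given an optimal CF-ON
-- coloring, keep the colors of Y and of one uniquely colored neighbor of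
-- each vertex of Y, give u a new color, and give all other vertices one new
-- dummy color 0.  This is a CF-ON coloring with χ + 2 colors in which at most
-- |Y| vertices outside Y are not dummies.  Only the adjacency to Y of these
-- matters, so they may be taken among the first few vertices of each of the
-- 2^|Y| types; this kernel has bounded size and all its colorings are tried,
-- for every candidate u and for every number of colors.  The output is the
-- last valid coloring found when the number of colors decreases.

module Submission where

open import Data.Bool.Base using (Bool; true; false; _∧_; not) renaming (if_then_else_ to when_then_else_)
import Data.Bool.Properties as Bool
open import Data.Empty using (⊥; ⊥-elim)
open import Data.Fin.Base using (Fin; zero; suc; toℕ; fromℕ<; punchIn; punchOut)
open import Data.Fin.Permutation.Components using (transpose; transpose-inverse)
import Data.Fin.Properties as Fin
open import Data.Fin.Subset using (Subset; ∣_∣; _∩_; ∁; inside; outside)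
open import Data.List.Base as List
  using (List; []; _∷_; length; foldl; foldr; reverse; _ʳ++_; zip; replicate; downFrom; tabulate; map; _++_)
open import Data.List.Membership.Propositional using (_∈_; _∉_; find; lose)
open import Data.List.Membership.Propositional.Properties
  using (∈-map⁺; ∈-map⁻; ∈-++⁺ˡ; ∈-++⁺ʳ; ∈-tabulate⁺; ∈-tabulate⁻; ∈-downFrom⁺; ∈-downFrom⁻)
open import Data.List.Properties
  using (reverse-involutive; reverse-foldl; length-reverse; length-zipWith; length-replicate; zipWith-zeroʳ;
         length-downFrom; length-map; length-++; length-tabulate; tabulate-lookup; tabulate-cong; ∷-injectiveˡ; ∷-injectiveʳ)
open import Data.List.Relation.Binary.Pointwise as Pointwise using (Pointwise; []; _∷_; Pointwise-length)
open import Data.List.Relation.Unary.All as All using (All; []; _∷_)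
open import Data.List.Relation.Unary.All.Properties using (replicate⁺; tabulate⁺; tabulate⁻)
open import Data.List.Relation.Unary.Any using (Any; here; there; any?)
open import Data.Nat.Base
open import Data.Nat.Properties
open import Data.Product.Base using (Σ; ∃-syntax; _×_; _,_; proj₁; proj₂)
open import Data.Sum.Base using (_⊎_; inj₁; inj₂; fromInj₂)
open import Data.Unit.Base using (⊤; tt)
import Data.Vec.Base as Vec
open import Function.Base using (_∘_; const; flip)
open import Relation.Binary.Construct.Closure.ReflexiveTransitive using (Star; ε; _◅_)
open import Relation.Binary.PropositionalEquality
open import Relation.Nullary using (¬_; Dec; yes; no; contradiction; does; map′)
open import Defs

-- An expression language compiled to programs

-- A vertex outside Y is served either by u, the only vertex of its color, or inside Y, where the
-- new coloring separates all that the optimal one separates. Neither case depends on the colors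
-- given outside Y, so these matter only to the vertices of Y, which cannot tell vertices of equal
-- type apart. This is why vertices of one type may exchange colors. The program knows neither u nor
-- χ. Every coloring that it keeps has been checked on the whole graph, so a wrong u does no harm,
-- while the right u guarantees success with χ + 2 colors. The number χ occurs only in the proof; it
-- exists because 2|Y| + 1 colors always suffice, and the same bound limits the number of colors to
-- be tried. The time bound concerns an explicit program. That program is a fixed nest of folds over
-- lists of length at most S, a bound depending on d times n, so its time is at most S to a power
-- read off from its syntax. This power splits into a factor for d and a factor for n.

-- An expression is evaluated in an environment tree  v₀ ∙ v₁ ∙ …  in which
-- var i  denotes  vᵢ.  The expression  f · a  evaluates  f  in the environment
-- that  a  produces, and in the body of  foldₑ l i b  the first two variables
-- are the current element and the accumulator.
data Exp : Set where
  env          : Exp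
  var          : ℕ → Exp
  nilₑ         : Exp
  hdₑ tlₑ      : Exp → Exp
  _∷ₑ_         : Exp → Exp → Exp
  ifₑ          : Exp → Exp → Exp → Exp
  letₑ         : Exp → Exp → Exp
  _·_          : Exp → Exp → Exp
  foldₑ        : Exp → Exp → Exp → Exp

infixr 5 _∷ₑ_
infixl 7 _·_

-- The loop state is `xs ∙ acc ∙ ρ`: the guard `hd` tests whether elements remain, and a round pops
-- the head `x` and runs the body in `x ∙ acc ∙ ρ`.
iteration : Prog → Prog
iteration b = pair (hd ⨟ tl) (pair (pair (hd ⨟ hd) tl ⨟ b) (tl ⨟ tl))

⟪_⟫ : Exp → Prog
⟪ env ⟫         = idᵖ
⟪ var zero ⟫    = hd
⟪ var (suc i) ⟫ = tl ⨟ ⟪ var i ⟫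
⟪ nilₑ ⟫        = nilᵖ
⟪ hdₑ a ⟫       = ⟪ a ⟫ ⨟ hd
⟪ tlₑ a ⟫       = ⟪ a ⟫ ⨟ tl
⟪ a ∷ₑ b ⟫      = pair ⟪ a ⟫ ⟪ b ⟫
⟪ ifₑ a b c ⟫   = if ⟪ a ⟫ then ⟪ b ⟫ else ⟪ c ⟫
⟪ letₑ a b ⟫    = pair ⟪ a ⟫ idᵖ ⨟ ⟪ b ⟫
⟪ f · a ⟫       = ⟪ a ⟫ ⨟ ⟪ f ⟫
⟪ foldₑ l i b ⟫ = pair ⟪ l ⟫ (pair ⟪ i ⟫ idᵖ) ⨟ (while hd run iteration ⟪ b ⟫) ⨟ tl ⨟ hd

-- The running time is at most  S ^ expo E  if every list that  E  folds over
-- has length at most S, where S ≥ 4.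
expo : Exp → ℕ
expo env           = 0
expo (var i)       = i
expo nilₑ          = 0
expo (hdₑ a)       = suc (expo a ⊔ 0)
expo (tlₑ a)       = suc (expo a ⊔ 0)
expo (a ∷ₑ b)      = suc (expo a ⊔ expo b)
expo (ifₑ a b c)   = suc (expo a ⊔ (expo b ⊔ expo c))
expo (letₑ a b)    = suc (suc (expo a ⊔ 0) ⊔ expo b)
expo (f · a)       = suc (expo a ⊔ expo f)
expo (foldₑ l i b) = suc (suc (expo l ⊔ suc (expo i ⊔ 0)) ⊔ suc ((expo b + 5) ⊔ 1))

hdᵗ tlᵗ : Tree → Tree
hdᵗ nil     = nil
hdᵗ (a ∙ _) = a
tlᵗ nil     = nil
tlᵗ (_ ∙ b) = b

infixl 9 _‼_
_‼_ : Tree → ℕ → Tree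
ρ ‼ zero  = hdᵗ ρ
ρ ‼ suc i = tlᵗ ρ ‼ i

-- The algorithm, as expressions and as functions on lists

bits : List Bool → Tree
bits = encList encBool

nats : List ℕ → Tree
nats = encList encℕ

infix 8 _⊗_
_⊗_ : ∀ {A B : Set} → (A → Tree) → (B → Tree) → A × B → Tree
(α ⊗ β) (a , b) = α a ∙ β b

trueₑ : Exp
trueₑ = nilₑ ∷ₑ nilₑ

xnor : Bool → Bool → Bool
xnor x y = when x then y else when y then false else true

_==_ : List Bool → List Bool → Bool
[]       == []       = true
[]       == (_ ∷ _)  = false
(_ ∷ _)  == []       = false
(x ∷ xs) == (y ∷ ys) = xnor x y ∧ (xs == ys)

-- A single fold over the first list; the accumulator pairs the verdict so far with the unread rest
-- of the second list. If the rest runs out early the verdict turns false for good, and a nonempty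
-- rest at the end means that the second list is longer.
eqStepₑ eqEndₑ eqₑ : Exp
eqStepₑ =
  ifₑ (tlₑ (var 1))
    (ifₑ (ifₑ (var 0) (hdₑ (tlₑ (var 1))) (ifₑ (hdₑ (tlₑ (var 1))) nilₑ trueₑ)) (hdₑ (var 1)) nilₑ
      ∷ₑ tlₑ (tlₑ (var 1)))
    (nilₑ ∷ₑ nilₑ)
eqEndₑ = ifₑ (tlₑ (var 0)) nilₑ (hdₑ (var 0))
eqₑ = letₑ (foldₑ (var 0) (trueₑ ∷ₑ var 1) eqStepₑ) eqEndₑ

-- The zip in reverse order, so that folding over it is a  foldr.
zipₑ : Exp
zipₑ = tlₑ (foldₑ (var 0) (var 1 ∷ₑ nilₑ)
  (tlₑ (hdₑ (var 1)) ∷ₑ (var 0 ∷ₑ hdₑ (hdₑ (var 1))) ∷ₑ tlₑ (var 1)))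

revₑ : Exp
revₑ = foldₑ (var 0) nilₑ (var 0 ∷ₑ var 1)

-- Colors are compared as lists of `false` because `encℕ c` is literally the encoding of such a
-- list, so `eqₑ` also compares numbers.
countStep : ℕ → Bool × ℕ → ℕ → ℕ
countStep c (b , x) n = when b then when replicate c false == replicate x false then suc n else n else n

count : ℕ → List (Bool × ℕ) → ℕ
count c = foldr (countStep c) 0

countₑ : Exp
countₑ = foldₑ (var 1) nilₑ
  (ifₑ (hdₑ (var 0)) (ifₑ (eqₑ · (var 2 ∷ₑ tlₑ (var 0) ∷ₑ nilₑ)) (nilₑ ∷ₑ var 1) (var 1)) (var 1))

isOne : ℕ → Bool
isOne (suc zero) = true
isOne _          = false

isOneₑ : Exp
isOneₑ = ifₑ (var 0) (ifₑ (tlₑ (var 0)) nilₑ trueₑ) nilₑ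

-- Only the entries of `s` are tried as colors: a color that is unique in a neighborhood occurs in
-- `s`.
rowOK : List Bool → List ℕ → Bool
rowOK row s = foldl (λ acc c → when isOne (count c (zip row s)) then true else acc) false s

rowOKₑ : Exp
rowOKₑ = letₑ (zipₑ · (var 0 ∷ₑ var 1 ∷ₑ nilₑ))
  (foldₑ (var 2) nilₑ (ifₑ (isOneₑ · ((countₑ · (var 0 ∷ₑ var 2 ∷ₑ nilₑ)) ∷ₑ nilₑ)) trueₑ (var 1)))

check : List ℕ → List (List Bool) → Bool
check s = foldl (λ acc row → when rowOK row s then acc else false) true

checkₑ : Exp
checkₑ = foldₑ (var 1) trueₑ (ifₑ (rowOKₑ · (var 0 ∷ₑ var 2 ∷ₑ nilₑ)) (var 1) nilₑ)

typStep : Bool × Bool → List Bool → List Bool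
typStep (a , b) t = (when a then b else false) ∷ t

-- Vertices outside `X` are masked by `false` rather than dropped, so that types of different
-- vertices can be compared position by position.
typ : List Bool → List Bool → List Bool
typ row X = foldr typStep [] (zip row X)

typₑ : Exp
typₑ = foldₑ (zipₑ · (var 0 ∷ₑ var 1 ∷ₑ nilₑ)) nilₑ (ifₑ (hdₑ (var 0)) (tlₑ (var 0)) nilₑ ∷ₑ var 1)

-- Counting down from `K` turns the comparison of a count with `K` into a test for zero.
room : List Bool → List (List Bool) → ℕ → ℕ
room t ts K = foldl (λ r t′ → when t′ == t then pred r else r) K ts

roomₑ : Exp
roomₑ = foldₑ (var 1) (var 2) (ifₑ (eqₑ · (var 0 ∷ₑ var 2 ∷ₑ nilₑ)) (tlₑ (var 1)) (var 1))

positive : ℕ → Bool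
positive zero    = false
positive (suc _) = true

-- A vertex is marked if it lies in X or fewer than K later vertices have its type.
markStep : List Bool → ℕ → List Bool × Bool → List (List Bool) × List Bool → List (List Bool) × List Bool
markStep X K (row , x) (ts , ms) =
  typ row X ∷ ts , (when x then true else positive (room (typ row X) ts K)) ∷ ms

typesAndMarks : List Bool → ℕ → List (List Bool × Bool) → List (List Bool) × List Bool
typesAndMarks X K = foldr (markStep X K) ([] , [])

marks : List (List Bool) → List Bool → ℕ → List Bool
marks rows X K = proj₂ (typesAndMarks X K (zip rows X))

marksₑ : Exp
marksₑ = tlₑ (foldₑ (zipₑ · (var 0 ∷ₑ var 1 ∷ₑ nilₑ)) (nilₑ ∷ₑ nilₑ)
  (letₑ (typₑ · (hdₑ (var 0) ∷ₑ var 3 ∷ₑ nilₑ))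
    ((var 0 ∷ₑ hdₑ (var 2)) ∷ₑ
     ifₑ (tlₑ (var 1)) trueₑ (ifₑ (roomₑ · (var 0 ∷ₑ hdₑ (var 2) ∷ₑ var 5 ∷ₑ nilₑ)) trueₑ nilₑ) ∷ₑ
     tlₑ (var 2))))

ext : List ℕ → List (List ℕ) → List (List ℕ)
ext cs ss = foldl (λ out c → foldl (λ o s → (c ∷ s) ∷ o) out ss) [] cs

extₑ : Exp
extₑ = foldₑ (var 0) nilₑ (foldₑ (var 3) (var 1) ((var 2 ∷ₑ var 0) ∷ₑ var 1))

candStep : List ℕ → Bool → List (List ℕ) → List (List ℕ)
candStep cs m ss = ext (when m then cs else 0 ∷ []) ss

cands : List ℕ → List Bool → List (List ℕ)
cands cs = foldr (candStep cs) ([] ∷ [])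

candsₑ : Exp
candsₑ = foldₑ (revₑ · (var 0 ∷ₑ nilₑ)) (nilₑ ∷ₑ nilₑ)
  (extₑ · (ifₑ (var 0) (var 3) (nilₑ ∷ₑ nilₑ) ∷ₑ var 1 ∷ₑ nilₑ))

downₑ : Exp
downₑ = foldₑ (var 0) (nilₑ ∷ₑ nilₑ) ((nilₑ ∷ₑ hdₑ (var 1)) ∷ₑ var 1)

-- 4 + 2|X|, both the number of marked vertices per type and a bound for the colors.
budget : List Bool → ℕ
budget = foldl (λ j x → when x then 2 + j else j) 4

natₑ : ℕ → Exp
natₑ zero    = nilₑ
natₑ (suc i) = nilₑ ∷ₑ natₑ i

budgetₑ : Exp
budgetₑ = foldₑ (var 0) (natₑ 4) (ifₑ (var 0) (nilₑ ∷ₑ nilₑ ∷ₑ var 1) (var 1))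

-- plants X  lists the sets X ∪ {u}.
plantStep : Bool → List Bool × List (List Bool) → List Bool × List (List Bool)
plantStep x (X , out) = x ∷ X , foldl (λ o Y → (x ∷ Y) ∷ o) ((true ∷ X) ∷ []) out

suffixAndPlants : List Bool → List Bool × List (List Bool)
suffixAndPlants = foldr plantStep ([] , [])

plants : List Bool → List (List Bool)
plants X = proj₂ (suffixAndPlants X)

plantsₑ : Exp
plantsₑ = tlₑ (foldₑ (revₑ · (var 0 ∷ₑ nilₑ)) (nilₑ ∷ₑ nilₑ)
  ((var 0 ∷ₑ hdₑ (var 1)) ∷ₑ
   foldₑ (tlₑ (var 1)) ((trueₑ ∷ₑ hdₑ (var 1)) ∷ₑ nilₑ) ((var 2 ∷ₑ var 0) ∷ₑ var 1)))

keep : List (List Bool) → List ℕ → List ℕ → List ℕ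
keep rows best s = when check s rows then s else best

-- Here `k` is the largest color on offer, so there are `k + 1` colors, the dummy 0 included.
tryPlant : List (List Bool) → ℕ → ℕ → List ℕ → List Bool → List ℕ
tryPlant rows K k best X = foldl (keep rows) best (cands (downFrom (suc k)) (marks rows X K))

level : List (List Bool) → List Bool → ℕ → List ℕ → ℕ → List ℕ
level rows X K best k = foldl (tryPlant rows K k) best (plants X)

search : List (List Bool) → List Bool → List ℕ
search rows X = foldl (level rows X (budget X)) [] (downFrom (suc (budget X)))

searchₑ : Exp
searchₑ = letₑ (budgetₑ · (var 1 ∷ₑ nilₑ))
  (foldₑ (downₑ · (var 0 ∷ₑ nilₑ)) nilₑ
    (foldₑ (plantsₑ · (var 4 ∷ₑ nilₑ)) (var 1)
      (foldₑ (candsₑ · ((marksₑ · (var 5 ∷ₑ var 0 ∷ₑ var 4 ∷ₑ nilₑ)) ∷ₑ (downₑ · (var 2 ∷ₑ nilₑ)) ∷ₑ nilₑ)) (var 1)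
        -- The environment is now: candidate, best, plant, best, level, best, budget, rows, `X`.
        -- Only the first of the three bests is current.
        (ifₑ (checkₑ · (var 0 ∷ₑ var 7 ∷ₑ nilₑ)) (var 0) (var 1)))))

-- Candidates and plants as lists

prepend : ∀ {A : Set} → A → List (List A) → List (List A) → List (List A)
prepend c = foldl (λ o s → (c ∷ s) ∷ o)

length-prepend : ∀ {A : Set} (c : A) (out ss : List (List A)) → length (prepend c out ss) ≡ length out + length ss
length-prepend c out []       = sym (+-identityʳ _)
length-prepend c out (s ∷ ss) = trans (length-prepend c _ ss) (sym (+-suc (length out) (length ss)))

length-ext : ∀ cs ss → length (ext cs ss) ≡ length cs * length ss
length-ext cs ss = go cs []
  where
  go : ∀ cs out → length (foldl (λ out c → prepend c out ss) out cs) ≡ length out + length cs * length ss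
  go []       out = sym (+-identityʳ _)
  go (c ∷ cs) out = trans (go cs _) (trans (cong (_+ length cs * length ss) (length-prepend c out ss)) (+-assoc (length out) (length ss) _))

∈-prepend⁻ : ∀ {A : Set} {c : A} {x} out ss → x ∈ prepend c out ss → x ∈ out ⊎ ∃[ s ] s ∈ ss × x ≡ c ∷ s
∈-prepend⁻ out []       m = inj₁ m
∈-prepend⁻ {c = c} out (s ∷ ss) m with ∈-prepend⁻ ((c ∷ s) ∷ out) ss m
... | inj₁ (here eq)     = inj₂ (s , here refl , eq)
... | inj₁ (there m)     = inj₁ m
... | inj₂ (s , m , eq)  = inj₂ (s , there m , eq)

∈-prepend⁺ˡ : ∀ {A : Set} {c : A} {x} out ss → x ∈ out → x ∈ prepend c out ss
∈-prepend⁺ˡ out []       m = m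
∈-prepend⁺ˡ out (s ∷ ss) m = ∈-prepend⁺ˡ _ ss (there m)

∈-prepend⁺ʳ : ∀ {A : Set} {c : A} {s} out ss → s ∈ ss → (c ∷ s) ∈ prepend c out ss
∈-prepend⁺ʳ out (s ∷ ss) (here refl) = ∈-prepend⁺ˡ _ ss (here refl)
∈-prepend⁺ʳ out (s ∷ ss) (there m)   = ∈-prepend⁺ʳ _ ss m

∈-ext⁻ : ∀ {x} cs ss → x ∈ ext cs ss → ∃[ c ] ∃[ s ] c ∈ cs × s ∈ ss × x ≡ c ∷ s
∈-ext⁻ {x} cs ss m = fromInj₂ (λ ()) (go [] cs m)
  where
  go : ∀ out cs → x ∈ foldl (λ out c → prepend c out ss) out cs → x ∈ out ⊎ ∃[ c ] ∃[ s ] c ∈ cs × s ∈ ss × x ≡ c ∷ s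
  go out []       m = inj₁ m
  go out (c ∷ cs) m with go (prepend c out ss) cs m
  ... | inj₂ (c , s , m , r) = inj₂ (c , s , there m , r)
  ... | inj₁ m with ∈-prepend⁻ out ss m
  ...   | inj₁ m            = inj₁ m
  ...   | inj₂ (s , m , eq) = inj₂ (c , s , here refl , m , eq)

∈-ext⁺ : ∀ {c s} cs ss → c ∈ cs → s ∈ ss → (c ∷ s) ∈ ext cs ss
∈-ext⁺ {c} {s} cs ss m m′ = go [] cs m
  where
  keep-out : ∀ {x} out cs → x ∈ out → x ∈ foldl (λ out c → prepend c out ss) out cs
  keep-out out []       m = m
  keep-out out (c ∷ cs) m = keep-out _ cs (∈-prepend⁺ˡ out ss m)
  go : ∀ out cs → c ∈ cs → (c ∷ s) ∈ foldl (λ out c → prepend c out ss) out cs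
  go out (c ∷ cs) (here refl) = keep-out _ cs (∈-prepend⁺ʳ out ss m′)
  go out (c ∷ cs) (there m)   = go _ cs m

Admissible : ℕ → Bool → ℕ → Set
Admissible k m c = c ≤ k × (m ≡ false → c ≡ 0)

∈-cands⁻ : ∀ {k s} ms → s ∈ cands (downFrom (suc k)) ms → Pointwise (Admissible k) ms s
∈-cands⁻ []       (here refl) = []
∈-cands⁻ {k} (m ∷ ms) r with ∈-ext⁻ (when m then downFrom (suc k) else 0 ∷ []) (cands (downFrom (suc k)) ms) r
∈-cands⁻ (true ∷ ms)  r | c , s , p , q , refl = (s≤s⁻¹ (∈-downFrom⁻ p) , λ ()) ∷ ∈-cands⁻ ms q
∈-cands⁻ (false ∷ ms) r | c , s , here refl , q , refl = (z≤n , λ _ → refl) ∷ ∈-cands⁻ ms q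

∈-cands⁺ : ∀ {k s} ms → Pointwise (Admissible k) ms s → s ∈ cands (downFrom (suc k)) ms
∈-cands⁺ []           []             = here refl
∈-cands⁺ {k} (true ∷ ms)  ((l , _) ∷ ps) = ∈-ext⁺ (downFrom (suc k)) _ (∈-downFrom⁺ (s≤s l)) (∈-cands⁺ ms ps)
∈-cands⁺ {k} (false ∷ ms) ((_ , z) ∷ ps) with refl ← z refl = ∈-ext⁺ (0 ∷ []) _ (here refl) (∈-cands⁺ ms ps)

cands-bounded : ∀ {k s} ms → s ∈ cands (downFrom (suc k)) ms → All (_≤ k) s
cands-bounded ms m = go (∈-cands⁻ ms m)
  where
  go : ∀ {k ms s} → Pointwise (Admissible k) ms s → All (_≤ k) s
  go []             = []
  go ((l , _) ∷ ps) = l ∷ go ps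

length-marks : ∀ rows X Y K → length rows ≡ length Y → length (proj₂ (typesAndMarks X K (zip rows Y))) ≡ length Y
length-marks []         X []      K h = refl
length-marks (_ ∷ rows) X (_ ∷ Y) K h = cong suc (length-marks rows X Y K (suc-injective h))

proj₁-suffixAndPlants : ∀ X → proj₁ (suffixAndPlants X) ≡ X
proj₁-suffixAndPlants []      = refl
proj₁-suffixAndPlants (x ∷ X) = cong (x ∷_) (proj₁-suffixAndPlants X)

∈-plants⁻ : ∀ {Y} x X → Y ∈ plants (x ∷ X) → Y ≡ true ∷ X ⊎ ∃[ Z ] Z ∈ plants X × Y ≡ x ∷ Z
∈-plants⁻ x X m with ∈-prepend⁻ _ (plants X) m
... | inj₂ r        = inj₂ r
... | inj₁ (here r) = inj₁ (trans r (cong (true ∷_) (proj₁-suffixAndPlants X)))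

plants-length : ∀ {Y} X → Y ∈ plants X → length Y ≡ length X
plants-length (x ∷ X) m with ∈-plants⁻ x X m
... | inj₁ refl           = refl
... | inj₂ (Z , m , refl) = cong suc (plants-length X m)

encℕ-bits : ∀ c → encℕ c ≡ bits (replicate c false)
encℕ-bits zero    = refl
encℕ-bits (suc c) = cong (nil ∙_) (encℕ-bits c)

length-typ : ∀ row X → length (typ row X) ≤ length X
length-typ []        X       = z≤n
length-typ (_ ∷ _)   []      = z≤n
length-typ (_ ∷ row) (_ ∷ X) = s≤s (length-typ row X)

length-plants : ∀ X → length (plants X) ≡ length X
length-plants []      = refl
length-plants (x ∷ X) = trans (length-prepend x _ (plants X)) (cong suc (length-plants X))

-- Evaluation with time bounds

-- The time bounds hold under the assumption  Strict, so that Strict = ⊥ gives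
-- pure termination.
module Run (Strict : Set) (S : ℕ) (4≤S : Strict → 4 ≤ S) where

  Within : ℕ → ℕ → Set
  Within t e = Strict → t ≤ S ^ e

  Small : ℕ → Set
  Small l = Strict → l ≤ S

  infix 3 _∶_⇒_
  record _∶_⇒_ (E : Exp) (ρ v : Tree) : Set where
    constructor runs
    field
      time       : ℕ
      derivation : ⟪ E ⟫ ⊢ ρ ⇓ v [ time ]
      within     : Within time (expo E)

  1≤S^ : ∀ e → Strict → 1 ≤ S ^ e
  1≤S^ e s = >-nonZero⁻¹ _ {{m^n≢0 S e {{>-nonZero (≤-trans (s≤s z≤n) (4≤S s))}}}}

  S^-mono : ∀ {a b} → a ≤ b → Strict → S ^ a ≤ S ^ b
  S^-mono a≤b s = ^-monoʳ-≤ S {{>-nonZero (≤-trans (s≤s z≤n) (4≤S s))}} a≤b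

  unit : ∀ e → Within 1 e
  unit = 1≤S^

  -- The total is at most three times `S ^ (a ⊔ b)`, and 3 ≤ S turns the factor into one more power.
  -- A part that takes a single step has exponent 0, whence the `⊔ 0` in `expo`.
  both : ∀ {s t} a b → Within s a → Within t b → Within (suc (s + t)) (suc (a ⊔ b))
  both {s} {t} a b p q st = begin
    suc (s + t)                             ≤⟨ s≤s (+-mono-≤ (≤-trans (p st) (S^-mono (m≤m⊔n a b) st)) (≤-trans (q st) (S^-mono (m≤n⊔m a b) st))) ⟩
    suc (x + x)                             ≤⟨ +-monoˡ-≤ (x + x) (1≤S^ (a ⊔ b) st) ⟩
    x + (x + x)                             ≡⟨ cong (λ z → x + (x + z)) (sym (+-identityʳ x)) ⟩
    3 * x                                   ≤⟨ *-monoˡ-≤ x (≤-trans (n≤1+n 3) (4≤S st)) ⟩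
    S * x                                   ∎
    where open ≤-Reasoning ; x = S ^ (a ⊔ b)

  private variable
    ρ u v w : Tree
    a b c : Exp

  run-var : ∀ i → var i ∶ ρ ⇒ ρ ‼ i
  run-var {nil}   zero = runs 1 ⇓hd-nil (unit 0)
  run-var {_ ∙ _} zero = runs 1 ⇓hd-∙ (unit 0)
  run-var {nil}   (suc i) with run-var {nil} i
  ... | runs _ r h = runs _ (⇓⨟ ⇓tl-nil r) (both 0 i (unit 0) h)
  run-var {_ ∙ ρ} (suc i) with run-var {ρ} i
  ... | runs _ r h = runs _ (⇓⨟ ⇓tl-∙ r) (both 0 i (unit 0) h)

  run-env : env ∶ ρ ⇒ ρ
  run-env = runs 1 ⇓id (unit 0)

  run-nil : nilₑ ∶ ρ ⇒ nil
  run-nil = runs 1 ⇓nil (unit 0)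

  run-hd : a ∶ ρ ⇒ v → hdₑ a ∶ ρ ⇒ hdᵗ v
  run-hd {a} {v = nil}   (runs _ r h) = runs _ (⇓⨟ r ⇓hd-nil) (both (expo a) 0 h (unit 0))
  run-hd {a} {v = _ ∙ _} (runs _ r h) = runs _ (⇓⨟ r ⇓hd-∙) (both (expo a) 0 h (unit 0))

  run-tl : a ∶ ρ ⇒ v → tlₑ a ∶ ρ ⇒ tlᵗ v
  run-tl {a} {v = nil}   (runs _ r h) = runs _ (⇓⨟ r ⇓tl-nil) (both (expo a) 0 h (unit 0))
  run-tl {a} {v = _ ∙ _} (runs _ r h) = runs _ (⇓⨟ r ⇓tl-∙) (both (expo a) 0 h (unit 0))

  infixr 5 _⟨∷⟩_
  _⟨∷⟩_ : a ∶ ρ ⇒ v → b ∶ ρ ⇒ w → a ∷ₑ b ∶ ρ ⇒ v ∙ w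
  _⟨∷⟩_ {a} {b = b} (runs _ r h) (runs _ q k) = runs _ (⇓pair r q) (both (expo a) (expo b) h k)

  run-let : a ∶ ρ ⇒ v → b ∶ v ∙ ρ ⇒ w → letₑ a b ∶ ρ ⇒ w
  run-let {a} {b = b} (runs _ r h) (runs _ q k) =
    runs _ (⇓⨟ (⇓pair r ⇓id) q) (both _ (expo b) (both (expo a) 0 h (unit 0)) k)

  run-call : a ∶ ρ ⇒ v → b ∶ v ⇒ w → b · a ∶ ρ ⇒ w
  run-call {a} {b = b} (runs _ r h) (runs _ q k) = runs _ (⇓⨟ r q) (both (expo a) (expo b) h k)

  weaken : ∀ {t x y} → x ≤ y → Within t x → Within t y
  weaken x≤y h s = ≤-trans (h s) (S^-mono x≤y s)

  run-then : a ∶ ρ ⇒ u ∙ v → b ∶ ρ ⇒ w → ifₑ a b c ∶ ρ ⇒ w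
  run-then {a} {b = b} {c = c} (runs _ r h) (runs _ q k) =
    runs _ (⇓then r q) (both (expo a) (expo b ⊔ expo c) h (weaken (m≤m⊔n (expo b) _) k))

  run-else : a ∶ ρ ⇒ nil → c ∶ ρ ⇒ w → ifₑ a b c ∶ ρ ⇒ w
  run-else {a} {c = c} {b = b} (runs _ r h) (runs _ q k) =
    runs _ (⇓else r q) (both (expo a) (expo b ⊔ expo c) h (weaken (m≤n⊔m (expo b) _) k))

  run-if : ∀ {A : Set} {enc : A → Tree} {y z : A} x → a ∶ ρ ⇒ encBool x → b ∶ ρ ⇒ enc y → c ∶ ρ ⇒ enc z →
           ifₑ a b c ∶ ρ ⇒ enc (when x then y else z)
  run-if false r p q = run-else r q
  run-if true  r p q = run-then r p

  module _ {A B : Set} {α : A → Tree} {β : B → Tree} {f : B → A → B} (P : List A → B → Set) where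

    Body : Exp → Tree → Set
    Body b ρ = ∀ x xs y → P (x ∷ xs) y → (b ∶ α x ∙ β y ∙ ρ ⇒ β (f y x)) × P xs (f y x)

    -- `P` is a loop invariant on the unread list and the accumulator. The extra round in
    -- `suc (length xs)` pays for the final failing test.
    run-loop : Body b ρ → ∀ xs y → P xs y → ∃[ t ]
               (while hd run iteration ⟪ b ⟫ ⊢ encList α xs ∙ β y ∙ ρ ⇓ nil ∙ β (foldl f y xs) ∙ ρ [ t ]) ×
               (Strict → t ≤ suc (length xs) * S ^ (expo b + 3))
    run-loop {b} body [] y p = 2 , ⇓stop ⇓hd-∙ , λ s → begin
        2                          ≤⟨ s≤s (s≤s z≤n) ⟩
        4                          ≤⟨ 4≤S s ⟩
        S                          ≡⟨ sym (^-identityʳ S) ⟩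
        S ^ 1                      ≤⟨ S^-mono (≤-trans (s≤s z≤n) (m≤n+m 3 (expo b))) s ⟩
        S ^ (expo b + 3)           ≡⟨ sym (+-identityʳ _) ⟩
        1 * S ^ (expo b + 3)       ∎
      where open ≤-Reasoning
    run-loop {b} body (x ∷ xs) y p with body x xs y p
    ... | runs t r h , p′ with run-loop body xs (f y x) p′
    ... | t′ , r′ , h′ = _ ,
      ⇓loop ⇓hd-∙ (⇓pair (⇓⨟ ⇓hd-∙ ⇓tl-∙) (⇓pair (⇓⨟ (⇓pair (⇓⨟ ⇓hd-∙ ⇓hd-∙) ⇓tl-∙) r) (⇓⨟ ⇓tl-∙ ⇓tl-∙))) r′ ,
      λ s → begin
        suc (suc (11 + (t + 3)) + t′)          ≡⟨ cong (λ z → 13 + z + t′) (+-comm t 3) ⟩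
        16 + t + t′                            ≤⟨ +-mono-≤ (one s) (h′ s) ⟩
        S ^ (expo b + 3) + suc (length xs) * S ^ (expo b + 3) ∎
      where
      open ≤-Reasoning
      one : Strict → 16 + t ≤ S ^ (expo b + 3)
      one s = begin
        16 + t                ≤⟨ +-mono-≤ (*-mono-≤ (≤-refl {16}) (1≤S^ (expo b) s)) (h s) ⟩
        16 * z + z            ≡⟨ +-comm (16 * z) z ⟩
        -- A round spends 16 steps outside the body, and 17 ≤ 4 ^ 3 ≤ S ^ 3 absorbs them.
        17 * z                ≤⟨ *-monoˡ-≤ z (≤-trans (m≤m+n 17 47) (^-monoˡ-≤ 3 (4≤S s))) ⟩
        S ^ 3 * z             ≡⟨ *-comm (S ^ 3) z ⟩
        z * S ^ 3             ≡⟨ sym (^-distribˡ-+-* S (expo b) 3) ⟩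
        S ^ (expo b + 3)      ∎
        where z = S ^ expo b

    run-fold : ∀ {i} xs y → Small (length xs) → c ∶ ρ ⇒ encList α xs → i ∶ ρ ⇒ β y → P xs y → Body b ρ →
               foldₑ c i b ∶ ρ ⇒ β (foldl f y xs)
    run-fold {c} {b = b} {i} xs y l (runs _ r h) (runs _ r′ h′) p body with run-loop {b} body xs y p
    ... | t , r″ , h″ = runs _
      (⇓⨟ (⇓pair r (⇓pair r′ ⇓id)) (⇓⨟ r″ (⇓⨟ ⇓tl-∙ ⇓hd-∙)))
      (both (suc (expo c ⊔ suc (expo i ⊔ 0))) (suc ((expo b + 5) ⊔ 1))
        (both (expo c) _ h (both (expo i) 0 h′ (unit 0)))
        (both (expo b + 5) 1 loop (both 0 0 (unit 0) (unit 0))))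
      where
      open ≤-Reasoning
      loop : Within t (expo b + 5)
      loop s = begin
        t                                       ≤⟨ h″ s ⟩
        -- At most 1 + S ≤ S ^ 2 rounds raise the 3 of a single round to the 5 in `expo`.
        suc (length xs) * S ^ (expo b + 3)      ≤⟨ *-monoˡ-≤ _ (s≤s (l s)) ⟩
        suc S * S ^ (expo b + 3)                ≤⟨ *-monoˡ-≤ _ (+-monoˡ-≤ S (≤-trans (s≤s z≤n) (4≤S s))) ⟩
        (S + S) * S ^ (expo b + 3)              ≡⟨ cong (λ z → (S + z) * S ^ (expo b + 3)) (sym (+-identityʳ S)) ⟩
        2 * S * S ^ (expo b + 3)                ≤⟨ *-monoˡ-≤ _ (*-monoˡ-≤ S (≤-trans (s≤s (s≤s z≤n)) (4≤S s))) ⟩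
        S * S * S ^ (expo b + 3)                ≡⟨ *-assoc S S _ ⟩
        S ^ (2 + (expo b + 3))                  ≡⟨ cong (S ^_) (trans (+-comm 2 _) (+-assoc (expo b) 3 2)) ⟩
        S ^ (expo b + 5)                        ∎

  -- A right fold is a left fold over the reversed list. The invariant remembers the suffix `done`
  -- already consumed, whose right fold is the accumulator; since `Q` passes to tails, it holds for
  -- every such suffix.
  run-foldr : ∀ {A B : Set} {α : A → Tree} {β : B → Tree} {g : A → B → B} {i y} xs (Q : List A → Set) →
              (∀ {x xs} → Q (x ∷ xs) → Q xs) → Q xs →
              Small (length (reverse xs)) → c ∶ ρ ⇒ encList α (reverse xs) → i ∶ ρ ⇒ β y →
              (∀ x xs → Q (x ∷ xs) → b ∶ α x ∙ β (foldr g y xs) ∙ ρ ⇒ β (g x (foldr g y xs))) →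
              foldₑ c i b ∶ ρ ⇒ β (foldr g y xs)
  run-foldr {b = b} {α = α} {β} {g} {i} {y} xs Q tail q l r r′ body =
    subst (λ z → foldₑ _ i b ∶ _ ⇒ β z) (reverse-foldl (λ z x → g x z) y xs)
      (run-fold {α = α} {β} {λ z x → g x z} P (reverse xs) y l r r′ ([] , subst Q (sym (reverse-involutive xs)) q , refl) step)
    where
    P = λ rest z → ∃[ done ] Q (rest ʳ++ done) × z ≡ foldr g y done
    untail : ∀ rest {done} → Q (rest ʳ++ done) → Q done
    untail []         q = q
    untail (x ∷ rest) q = tail (untail rest q)
    step : ∀ x rest z → P (x ∷ rest) z → (b ∶ α x ∙ β z ∙ _ ⇒ β (g x z)) × P rest (g x z)
    step x rest .(foldr g y done) (done , q , refl) = body x done (untail rest q) , x ∷ done , q , refl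

  run-foldAll : ∀ {A B : Set} {α : A → Tree} {β : B → Tree} {f : B → A → B} {R : A → Set} {c i b ρ y} xs →
                All R xs → Small (length xs) → c ∶ ρ ⇒ encList α xs → i ∶ ρ ⇒ β y →
                (∀ y x → R x → b ∶ α x ∙ β y ∙ ρ ⇒ β (f y x)) → foldₑ c i b ∶ ρ ⇒ β (foldl f y xs)
  run-foldAll {α = α} {β} {f} {R} {b = b} {ρ} {y} xs rs l r r′ body =
    run-fold {α = α} {β} {f} (λ xs _ → All R xs) xs y l r r′ rs λ { x xs y (r ∷ rs) → body y x r , rs }

  run-fold⊤ : ∀ {A B : Set} {α : A → Tree} {β : B → Tree} {f : B → A → B} {c i b ρ y} xs →
              Small (length xs) → c ∶ ρ ⇒ encList α xs → i ∶ ρ ⇒ β y →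
              (∀ y x → b ∶ α x ∙ β y ∙ ρ ⇒ β (f y x)) → foldₑ c i b ∶ ρ ⇒ β (foldl f y xs)
  run-fold⊤ {α = α} {β} {f} {y = y} xs l r r′ body =
    run-fold {α = α} {β} {f} (λ _ _ → ⊤) xs y l r r′ tt λ x xs y _ → body y x , tt

  run-ifB : ∀ {a b c ρ y z} x → a ∶ ρ ⇒ encBool x → b ∶ ρ ⇒ encBool y → c ∶ ρ ⇒ encBool z →
            ifₑ a b c ∶ ρ ⇒ encBool (when x then y else z)
  run-ifB = run-if {enc = encBool}

  run-true : ∀ {ρ} → trueₑ ∶ ρ ⇒ encBool true
  run-true = run-nil ⟨∷⟩ run-nil

  small-reverse : ∀ {A : Set} (xs : List A) → Small (length xs) → Small (length (reverse xs))
  small-reverse xs l s = subst (_≤ S) (sym (length-reverse xs)) (l s)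

  run-eq : ∀ a b → Small (length a) → eqₑ ∶ bits a ∙ bits b ∙ nil ⇒ encBool (a == b)
  run-eq a b l =
    run-let (run-fold⊤ {β = encBool ⊗ bits} {step} a l (run-var 0) (run-true ⟨∷⟩ run-var 1) body)
      (finish (foldl step (true , b) a) (correct a true b))
    where
    step : Bool × List Bool → Bool → Bool × List Bool
    step (f , [])     x = false , []
    step (f , y ∷ ys) x = (when xnor x y then f else false) , ys
    body : ∀ {ρ} y x → eqStepₑ ∶ encBool x ∙ (encBool ⊗ bits) y ∙ ρ ⇒ (encBool ⊗ bits) (step y x)
    body (f , [])     x = run-else (run-tl (run-var 1)) (run-nil ⟨∷⟩ run-nil)
    body (f , y ∷ ys) x = run-then (run-tl (run-var 1))
      (run-ifB (xnor x y)
         (run-ifB x (run-var 0) (run-hd (run-tl (run-var 1))) (run-ifB y (run-hd (run-tl (run-var 1))) run-nil run-true))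
         (run-hd (run-var 1)) run-nil
       ⟨∷⟩ run-tl (run-tl (run-var 1)))
    value : Bool × List Bool → Bool
    value (f , [])    = f
    value (f , _ ∷ _) = false
    finish : ∀ {ρ} y → value y ≡ (a == b) → eqEndₑ ∶ (encBool ⊗ bits) y ∙ ρ ⇒ encBool (a == b)
    finish (f , [])     eq = subst (λ z → eqEndₑ ∶ _ ∙ _ ⇒ encBool z) eq (run-else (run-tl (run-var 0)) (run-hd (run-var 0)))
    finish (f , _ ∷ _)  eq = subst (λ z → eqEndₑ ∶ _ ∙ _ ⇒ encBool z) eq (run-then (run-tl (run-var 0)) run-nil)
    failed : ∀ a b → value (foldl step (false , b) a) ≡ false
    failed []      []      = refl
    failed []      (_ ∷ _) = refl
    failed (x ∷ a) []      = failed a []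
    failed (x ∷ a) (y ∷ b) with xnor x y
    ... | true  = failed a b
    ... | false = failed a b
    correct : ∀ a f b → value (foldl step (f , b) a) ≡ (when f then a == b else false)
    correct a false b = failed a b
    correct []      true []      = refl
    correct []      true (_ ∷ _) = refl
    correct (x ∷ a) true []      = failed a []
    correct (x ∷ a) true (y ∷ b) with xnor x y
    ... | true  = correct a true b
    ... | false = failed a b

  run-zip : ∀ {A B : Set} {α : A → Tree} {β : B → Tree} as bs → Small (length as) → length as ≤ length bs →
            zipₑ ∶ encList α as ∙ encList β bs ∙ nil ⇒ encList (α ⊗ β) (reverse (zip as bs))
  run-zip {A} {B} {α} {β} as bs l h =
    subst (λ z → zipₑ ∶ encList α as ∙ encList β bs ∙ nil ⇒ encList (α ⊗ β) z) (correct as bs [])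
      (run-tl (run-fold {α = α} {encList β ⊗ encList (α ⊗ β)} {step} P as (bs , []) l (run-var 0) (run-var 1 ⟨∷⟩ run-nil) h body))
    where
    step : List B × List (A × B) → A → List B × List (A × B)
    step ([] , out)     a = [] , out
    step (b ∷ bs , out) a = bs , (a , b) ∷ out
    P : List A → List B × List (A × B) → Set
    P as (bs , _) = length as ≤ length bs
    body : Body P _ _
    body x xs (y ∷ ys , out) (s≤s h) =
      (run-tl (run-hd (run-var 1)) ⟨∷⟩ (run-var 0 ⟨∷⟩ run-hd (run-hd (run-var 1))) ⟨∷⟩ run-tl (run-var 1)) , h
    correct : ∀ as bs out → proj₂ (foldl step (bs , out) as) ≡ zip as bs ʳ++ out
    correct []       bs       out = refl
    correct (a ∷ as) []       out = trans (correct as [] out) (cong (_ʳ++ out) (zipWith-zeroʳ _,_ as))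
    correct (a ∷ as) (b ∷ bs) out = correct as bs ((a , b) ∷ out)

  run-rev : ∀ {A : Set} {α : A → Tree} xs → Small (length xs) → revₑ ∶ encList α xs ∙ nil ⇒ encList α (reverse xs)
  run-rev {α = α} xs l = run-fold⊤ {α = α} {β = encList α} {flip _∷_} xs l (run-var 0) run-nil λ _ _ → run-var 0 ⟨∷⟩ run-var 1

  run-eqℕ : ∀ c x → Small c → eqₑ ∶ encℕ c ∙ encℕ x ∙ nil ⇒ encBool (replicate c false == replicate x false)
  run-eqℕ c x l rewrite encℕ-bits c | encℕ-bits x =
    run-eq (replicate c false) (replicate x false) λ s → subst (_≤ S) (sym (length-replicate c)) (l s)

  run-count : ∀ c z → Small c → Small (length z) →
              countₑ ∶ encℕ c ∙ encList (encBool ⊗ encℕ) (reverse z) ∙ nil ⇒ encℕ (count c z)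
  run-count c z l l′ =
    run-foldr {α = encBool ⊗ encℕ} {encℕ} {countStep c} z (λ _ → ⊤) (λ _ → tt) tt (small-reverse z l′) (run-var 1) run-nil
      λ { (b , x) z _ → run-if {enc = encℕ} b (run-hd (run-var 0))
            (run-if {enc = encℕ} (replicate c false == replicate x false)
              (run-call (run-var 2 ⟨∷⟩ run-tl (run-var 0) ⟨∷⟩ run-nil) (run-eqℕ c x l))
              (run-nil ⟨∷⟩ run-var 1) (run-var 1))
            (run-var 1) }

  run-isOne : ∀ m → isOneₑ ∶ encℕ m ∙ nil ⇒ encBool (isOne m)
  run-isOne zero          = run-else (run-var 0) run-nil
  run-isOne (suc zero)    = run-then (run-var 0) (run-else (run-tl (run-var 0)) run-true)
  run-isOne (suc (suc m)) = run-then (run-var 0) (run-then (run-tl (run-var 0)) run-nil)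

  small-zip : ∀ {A B : Set} (as : List A) (bs : List B) → Small (length as) → Small (length (zip as bs))
  small-zip as bs l s = ≤-trans (≤-reflexive (length-zipWith _,_ as bs)) (≤-trans (m⊓n≤m (length as) (length bs)) (l s))

  run-rowOK : ∀ row s → Small (length s) → length row ≡ length s → All Small s →
              rowOKₑ ∶ bits row ∙ nats s ∙ nil ⇒ encBool (rowOK row s)
  run-rowOK row s l h sm =
    run-let (run-call (run-var 0 ⟨∷⟩ run-var 1 ⟨∷⟩ run-nil) (run-zip row s row-small (≤-reflexive h)))
      (run-foldAll {α = encℕ} {β = encBool} s sm l (run-var 2) run-nil λ acc c c-small →
        run-ifB (isOne (count c (zip row s)))
          (run-call (run-call (run-var 0 ⟨∷⟩ run-var 2 ⟨∷⟩ run-nil) (run-count c (zip row s) c-small (small-zip row s row-small)) ⟨∷⟩ run-nil)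
            (run-isOne (count c (zip row s))))
          run-true (run-var 1))
    where
    row-small : Small (length row)
    row-small st = subst (_≤ S) (sym h) (l st)

  run-check : ∀ s rows → Small (length s) → All Small s → Small (length rows) → All (λ row → length row ≡ length s) rows →
              checkₑ ∶ nats s ∙ encList bits rows ∙ nil ⇒ encBool (check s rows)
  run-check s rows l sm l′ hs =
    run-foldAll {α = bits} {β = encBool} rows hs l′ (run-var 1) run-true λ acc row h →
      run-ifB (rowOK row s) (run-call (run-var 0 ⟨∷⟩ run-var 2 ⟨∷⟩ run-nil) (run-rowOK row s l h sm)) (run-var 1) run-nil

  run-typ : ∀ row X → Small (length X) → length row ≡ length X → typₑ ∶ bits row ∙ bits X ∙ nil ⇒ bits (typ row X)
  run-typ row X l h =
    run-foldr {α = encBool ⊗ encBool} {β = bits} {typStep} (zip row X) (λ _ → ⊤) (λ _ → tt) tt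
      (small-reverse (zip row X) (small-zip row X row-small))
      (run-call (run-var 0 ⟨∷⟩ run-var 1 ⟨∷⟩ run-nil) (run-zip row X row-small (≤-reflexive h))) run-nil
      λ { (a , b) _ _ → run-ifB a (run-hd (run-var 0)) (run-tl (run-var 0)) run-nil ⟨∷⟩ run-var 1 }
    where
    row-small : Small (length row)
    row-small st = subst (_≤ S) (sym h) (l st)

  run-room : ∀ t ts K → Small (length ts) → All (λ t′ → Small (length t′)) ts →
             roomₑ ∶ bits t ∙ encList bits ts ∙ encℕ K ∙ nil ⇒ encℕ (room t ts K)
  run-room t ts K l hs =
    run-foldAll {α = bits} {β = encℕ} ts hs l (run-var 1) (run-var 2) λ r t′ h →
      run-if {enc = encℕ} (t′ == t) (run-call (run-var 0 ⟨∷⟩ run-var 2 ⟨∷⟩ run-nil) (run-eq t′ t h)) (run-pred r) (run-var 1)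
    where
    run-pred : ∀ {u ρ} r → tlₑ (var 1) ∶ u ∙ encℕ r ∙ ρ ⇒ encℕ (pred r)
    run-pred zero    = run-tl (run-var 1)
    run-pred (suc r) = run-tl (run-var 1)

  run-marks : ∀ rows X K → Small (length X) → length rows ≡ length X → All (λ row → length row ≡ length X) rows →
              marksₑ ∶ encList bits rows ∙ bits X ∙ encℕ K ∙ nil ⇒ bits (marks rows X K)
  run-marks rows X K l h hs = run-tl
    (run-foldr {α = bits ⊗ encBool} {encList bits ⊗ bits} {markStep X K} (zip rows X) Q Q-tail Q-zip
      (small-reverse (zip rows X) (small-zip rows X rows-small))
      (run-call (run-var 0 ⟨∷⟩ run-var 1 ⟨∷⟩ run-nil) (run-zip rows X rows-small (≤-reflexive h)))
      (run-nil ⟨∷⟩ run-nil) body)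
    where
    Q : List (List Bool × Bool) → Set
    Q zs = Small (length zs) × All (λ z → length (proj₁ z) ≡ length X) zs
    Q-tail : ∀ {z zs} → Q (z ∷ zs) → Q zs
    Q-tail (l , _ ∷ hs) = (λ st → ≤-trans (n≤1+n _) (l st)) , hs
    rows-small : Small (length rows)
    rows-small st = subst (_≤ S) (sym h) (l st)
    zipAll : ∀ {rows} (bs : List Bool) → All (λ row → length row ≡ length X) rows → All (λ z → length (proj₁ z) ≡ length X) (zip rows bs)
    zipAll _        []       = []
    zipAll []       (_ ∷ _)  = []
    zipAll (_ ∷ bs) (h ∷ hs) = h ∷ zipAll bs hs
    Q-zip : Q (zip rows X)
    Q-zip = small-zip rows X rows-small , zipAll X hs
    types-small : ∀ zs → Q zs → Small (length (proj₁ (typesAndMarks X K zs))) ×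
                  All (λ t → Small (length t)) (proj₁ (typesAndMarks X K zs))
    types-small zs q = (λ st → subst (_≤ S) (sym (len zs)) (proj₁ q st)) , typs zs
      where
      len : ∀ zs → length (proj₁ (typesAndMarks X K zs)) ≡ length zs
      len []       = refl
      len (z ∷ zs) = cong suc (len zs)
      typs : ∀ zs → All (λ t → Small (length t)) (proj₁ (typesAndMarks X K zs))
      typs []               = []
      typs ((row , x) ∷ zs) = (λ st → ≤-trans (length-typ row X) (l st)) ∷ typs zs
    run-positive : ∀ {a ρ} r → a ∶ ρ ⇒ encℕ r → ifₑ a trueₑ nilₑ ∶ ρ ⇒ encBool (positive r)
    run-positive zero    p = run-else p run-nil
    run-positive (suc r) p = run-then p run-true
    body : ∀ z zs → Q (z ∷ zs) → _ ∶ (bits ⊗ encBool) z ∙ (encList bits ⊗ bits) (typesAndMarks X K zs) ∙ _ ⇒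
           (encList bits ⊗ bits) (markStep X K z (typesAndMarks X K zs))
    body (row , x) zs q@(_ , hr ∷ _) =
      run-let (run-call (run-hd (run-var 0) ⟨∷⟩ run-var 3 ⟨∷⟩ run-nil) (run-typ row X l hr))
        ((run-var 0 ⟨∷⟩ run-hd (run-var 2)) ⟨∷⟩
         run-ifB x (run-tl (run-var 1)) run-true
           (run-positive _ (run-call (run-var 0 ⟨∷⟩ run-hd (run-var 2) ⟨∷⟩ run-var 5 ⟨∷⟩ run-nil)
             (run-room (typ row X) ts K (proj₁ small) (proj₂ small)))) ⟨∷⟩
         run-tl (run-var 2))
      where
      ts = proj₁ (typesAndMarks X K zs)
      small = types-small zs (Q-tail q)

  run-ext : ∀ cs ss → Small (length cs) → Small (length ss) →
            extₑ ∶ nats cs ∙ encList nats ss ∙ nil ⇒ encList nats (ext cs ss)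
  run-ext cs ss l l′ =
    run-fold⊤ {α = encℕ} {β = encList nats} cs l (run-var 0) run-nil λ out c →
      run-fold⊤ {α = nats} {β = encList nats} ss l′ (run-var 3) (run-var 1) λ o s →
        (run-var 2 ⟨∷⟩ run-var 0) ⟨∷⟩ run-var 1

  -- Because the color list is nonempty, no step shortens the list of candidates. A bound for the
  -- final list therefore bounds all intermediate ones.
  run-cands : ∀ c cs ms → let cs = c ∷ cs in Small (length cs) → Small (length ms) → Small (length (cands cs ms)) →
              candsₑ ∶ bits ms ∙ nats cs ∙ nil ⇒ encList nats (cands cs ms)
  run-cands c cs′ ms l l′ l″ =
    run-foldr {α = encBool} {encList nats} {candStep cs} ms (λ ms → Small (length (cands cs ms))) (λ {m} {ms} → tail m ms) l″
      (small-reverse ms l′) (run-call (run-var 0 ⟨∷⟩ run-nil) (run-rev {α = encBool} ms l′)) (run-nil ⟨∷⟩ run-nil)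
      λ m ms q → run-call (run-if {enc = nats} m (run-var 0) (run-var 3) (run-nil ⟨∷⟩ run-nil) ⟨∷⟩ run-var 1 ⟨∷⟩ run-nil)
        (run-ext (when m then cs else 0 ∷ []) (cands cs ms) (colors-small m) (tail m ms q))
    where
    cs = c ∷ cs′
    tail : ∀ m ms → Small (length (cands cs (m ∷ ms))) → Small (length (cands cs ms))
    tail true  ms q st = ≤-trans (m≤m+n _ _) (≤-trans (≤-reflexive (sym (length-ext cs (cands cs ms)))) (q st))
    tail false ms q st = ≤-trans (m≤m+n _ _) (≤-trans (≤-reflexive (sym (length-ext (0 ∷ []) (cands cs ms)))) (q st))
    colors-small : ∀ m → Small (length (when m then cs else 0 ∷ []))
    colors-small true  = l
    colors-small false st = ≤-trans (s≤s z≤n) (4≤S st)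

  -- A unary numeral is a list of `false`, so a fold over it is a counted loop; `β j` is the
  -- accumulator after `j` rounds.
  run-times : ∀ (β : ℕ → Tree) {l i b ρ} a → Small a → l ∶ ρ ⇒ encℕ a → i ∶ ρ ⇒ β 0 →
              (∀ j → b ∶ nil ∙ β j ∙ ρ ⇒ β (suc j)) → foldₑ l i b ∶ ρ ⇒ β a
  run-times β {l} {i} {b} {ρ} a sm r r′ body = subst (λ z → foldₑ l i b ∶ ρ ⇒ β z) (foldl-suc a 0)
    (run-foldAll {α = encBool} {β} {λ j _ → suc j} {_≡ false} (replicate a false) (replicate⁺ a refl)
      (λ st → subst (_≤ S) (sym (length-replicate a)) (sm st)) (subst (λ z → l ∶ ρ ⇒ z) (encℕ-bits a) r) r′
      λ { j _ refl → body j })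
    where
    foldl-suc : ∀ a j → foldl (λ j _ → suc j) j (replicate a false) ≡ j + a
    foldl-suc zero    j = sym (+-identityʳ j)
    foldl-suc (suc a) j = trans (foldl-suc a (suc j)) (sym (+-suc j a))

  run-natₑ : ∀ {ρ} i → natₑ i ∶ ρ ⇒ encℕ i
  run-natₑ zero    = run-nil
  run-natₑ (suc i) = run-nil ⟨∷⟩ run-natₑ i

  run-down : ∀ k → Small k → downₑ ∶ encℕ k ∙ nil ⇒ nats (downFrom (suc k))
  run-down k l = run-times (λ j → nats (downFrom (suc j))) k l (run-var 0) (run-nil ⟨∷⟩ run-nil)
    λ j → (run-nil ⟨∷⟩ run-hd (run-var 1)) ⟨∷⟩ run-var 1

  run-budget : ∀ X → Small (length X) → budgetₑ ∶ bits X ∙ nil ⇒ encℕ (budget X)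
  run-budget X l = run-fold⊤ {α = encBool} {β = encℕ} X l (run-var 0) (run-natₑ 4) λ j x →
    run-if {enc = encℕ} x (run-var 0) (run-nil ⟨∷⟩ run-nil ⟨∷⟩ run-var 1) (run-var 1)

  run-plants : ∀ X → Small (length X) → plantsₑ ∶ bits X ∙ nil ⇒ encList bits (plants X)
  run-plants X l = run-tl
    (run-foldr {α = encBool} {bits ⊗ encList bits} {plantStep} X (λ X → Small (length X)) (λ l st → ≤-trans (n≤1+n _) (l st)) l
      (small-reverse X l) (run-call (run-var 0 ⟨∷⟩ run-nil) (run-rev {α = encBool} X l)) (run-nil ⟨∷⟩ run-nil)
      λ x X l′ → (run-var 0 ⟨∷⟩ run-hd (run-var 1)) ⟨∷⟩
        run-fold⊤ {α = bits} {encList bits} (plants X)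
          (λ st → ≤-trans (≤-reflexive (length-plants X)) (≤-trans (n≤1+n _) (l′ st)))
          (run-tl (run-var 1)) ((run-true ⟨∷⟩ run-hd (run-var 1)) ⟨∷⟩ run-nil)
          λ o Y → (run-var 2 ⟨∷⟩ run-var 0) ⟨∷⟩ run-var 1)

  -- The candidates form the only list of exponential length; the hypothesis on them is where the
  -- size of the kernel enters the running time.
  run-search : ∀ rows X → Small (length X) → length rows ≡ length X → All (λ row → length row ≡ length X) rows →
               Small (suc (budget X)) →
               (∀ {Y k} → Y ∈ plants X → k ≤ budget X → Small (length (cands (downFrom (suc k)) (marks rows Y (budget X))))) →
               searchₑ ∶ encList bits rows ∙ bits X ∙ nil ⇒ nats (search rows X)
  run-search rows X l h hs K<S small-cands =
    run-let (run-call (run-var 1 ⟨∷⟩ run-nil) (run-budget X l))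
      (run-foldAll {α = encℕ} {nats} (downFrom (suc K)) (All.tabulate λ m → s≤s⁻¹ (∈-downFrom⁻ m))
        (λ st → subst (_≤ S) (sym (length-downFrom (suc K))) (K<S st))
        (run-call (run-var 0 ⟨∷⟩ run-nil) (run-down K (λ st → ≤-trans (n≤1+n K) (K<S st)))) run-nil λ best k k≤K →
      run-foldAll {α = bits} {nats} (plants X) (All.tabulate λ m → m)
        (λ st → subst (_≤ S) (sym (length-plants X)) (l st))
        (run-call (run-var 4 ⟨∷⟩ run-nil) (run-plants X l)) (run-var 1) λ best Y m →
      let hY = plants-length X m
          Y-small : Small (length Y)
          Y-small st = subst (_≤ S) (sym hY) (l st)
          hm = length-marks rows Y Y K (trans h (sym hY))
          k-small : Small (suc k)
          k-small st = ≤-trans (s≤s k≤K) (K<S st)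
      in
      run-foldAll {α = nats} {nats} (cands (downFrom (suc k)) (marks rows Y K)) (All.tabulate λ m → m) (small-cands m k≤K)
        (run-call
          (run-call (run-var 5 ⟨∷⟩ run-var 0 ⟨∷⟩ run-var 4 ⟨∷⟩ run-nil)
            (run-marks rows Y K Y-small (trans h (sym hY)) (All.map (λ e → trans e (sym hY)) hs))
           ⟨∷⟩ run-call (run-var 2 ⟨∷⟩ run-nil) (run-down k (λ st → ≤-trans (n≤1+n k) (k-small st))) ⟨∷⟩ run-nil)
          (run-cands k (downFrom k) (marks rows Y K)
            (λ st → subst (_≤ S) (sym (length-downFrom (suc k))) (k-small st))
            (λ st → subst (_≤ S) (sym hm) (Y-small st)) (small-cands m k≤K)))
        (run-var 1) λ best s s∈ →
      let hs′ = trans (sym (Pointwise-length (∈-cands⁻ (marks rows Y K) s∈))) (trans hm hY) in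
      run-if {enc = nats} (check s rows)
        (run-call (run-var 0 ⟨∷⟩ run-var 7 ⟨∷⟩ run-nil)
          (run-check s rows (λ st → subst (_≤ S) (sym hs′) (l st))
            (All.map (λ c≤k st → ≤-trans c≤k (≤-trans (n≤1+n k) (k-small st))) (cands-bounded (marks rows Y K) s∈))
            (λ st → subst (_≤ S) (sym h) (l st)) (All.map (λ e → trans e (sym hs′)) hs)))
        (run-var 0) (run-var 1))
    where
    K = budget X

-- Counting

xnor-true⁻ : ∀ x y → xnor x y ≡ true → x ≡ y
xnor-true⁻ true  true  _ = refl
xnor-true⁻ false false _ = refl

==⇒≡ : ∀ a b → (a == b) ≡ true → a ≡ b
==⇒≡ []      []      _ = refl
==⇒≡ (x ∷ a) (y ∷ b) h with xnor x y in eq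
... | true = cong₂ _∷_ (xnor-true⁻ x y eq) (==⇒≡ a b h)

==-refl : ∀ a → (a == a) ≡ true
==-refl []          = refl
==-refl (true ∷ a)  = ==-refl a
==-refl (false ∷ a) = ==-refl a

cnt : ∀ {n} → (Fin n → Bool) → ℕ
cnt {zero}  p = 0
cnt {suc n} p = when p zero then suc (cnt (p ∘ suc)) else cnt (p ∘ suc)

cnt-tail : ∀ {n} (p : Fin (suc n) → Bool) → cnt (p ∘ suc) ≤ cnt p
cnt-tail p with p zero
... | true  = n≤1+n _
... | false = ≤-refl

cnt-mono : ∀ {n} {p q : Fin n → Bool} → (∀ i → p i ≡ true → q i ≡ true) → cnt p ≤ cnt q
cnt-mono {zero}          h = z≤n
cnt-mono {suc n} {p} {q} h with p zero | q zero | h zero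
... | true  | true  | _ = s≤s (cnt-mono (h ∘ suc))
... | true  | false | f with () ← f refl
... | false | true  | _ = m≤n⇒m≤1+n (cnt-mono (h ∘ suc))
... | false | false | _ = cnt-mono (h ∘ suc)

cnt-split : ∀ {n} (p q : Fin n → Bool) → cnt p ≤ cnt (λ i → p i ∧ q i) + cnt (λ i → p i ∧ not (q i))
cnt-split {zero}  p q = z≤n
cnt-split {suc n} p q with p zero | q zero
... | false | _     = cnt-split (p ∘ suc) (q ∘ suc)
... | true  | true  = s≤s (cnt-split (p ∘ suc) (q ∘ suc))
... | true  | false = ≤-trans (s≤s (cnt-split (p ∘ suc) (q ∘ suc))) (≤-reflexive (sym (+-suc _ _)))

cnt-none : ∀ {n} {p : Fin n → Bool} → (∀ i → p i ≡ false) → cnt p ≡ 0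
cnt-none {zero}  h = refl
cnt-none {suc n} {p} h rewrite h zero = cnt-none (h ∘ suc)

cnt-some : ∀ {n} (p : Fin n → Bool) → 0 < cnt p → ∃[ i ] p i ≡ true
cnt-some {suc n} p h with p zero in eq
... | true  = zero , eq
... | false with cnt-some (p ∘ suc) h
...   | i , e = suc i , e

∧-true⁻ : ∀ {x y} → x ∧ y ≡ true → x ≡ true × y ≡ true
∧-true⁻ {true} h = refl , h

Unique : ∀ {n} → (Fin n → Bool) → Fin n → Set
Unique p y = p y ≡ true × (∀ z → p z ≡ true → z ≡ y)

cnt≡1⇒unique : ∀ {n} (p : Fin n → Bool) → cnt p ≡ 1 → ∃[ y ] Unique p y
cnt≡1⇒unique {suc n} p h with p zero in eq
... | false with cnt≡1⇒unique (p ∘ suc) h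
...   | y , e , u = suc y , e , λ { zero e′ → contradiction (trans (sym eq) e′) λ () ; (suc z) e′ → cong suc (u z e′) }
cnt≡1⇒unique {suc n} p h | true = zero , eq , λ
  { zero    _  → refl
  ; (suc z) e′ → contradiction (≤-trans (positive-cnt z e′) (≤-reflexive (suc-injective h))) λ () }
  where
  positive-cnt : ∀ {n} {p : Fin n → Bool} z → p z ≡ true → 1 ≤ cnt p
  positive-cnt {p = p} zero    e rewrite e = s≤s z≤n
  positive-cnt {p = p} (suc z) e = ≤-trans (positive-cnt z e) (cnt-tail p)

unique⇒cnt≡1 : ∀ {n} (p : Fin n → Bool) y → Unique p y → cnt p ≡ 1
unique⇒cnt≡1 {suc n} p zero (e , u) rewrite e = cong suc (cnt-none none)
  where
  none : ∀ i → p (suc i) ≡ false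
  none i with p (suc i) in eq
  ... | false = refl
  ... | true  with () ← u (suc i) eq
unique⇒cnt≡1 {suc n} p (suc y) (e , u) with p zero in eq
... | true  with () ← u zero eq
... | false = unique⇒cnt≡1 (p ∘ suc) y (e , λ z e′ → Fin.suc-injective (u (suc z) e′))

does-≟ : ∀ {k} {c d : Fin k} → does (c Fin.≟ d) ≡ true → c ≡ d
does-≟ {c = c} {d} e with c Fin.≟ d
... | yes r = r

does-≟-refl : ∀ {k} (c : Fin k) → does (c Fin.≟ c) ≡ true
does-≟-refl c with c Fin.≟ c
... | yes _ = refl
... | no ne = contradiction refl ne

-- Striking the first entry of the list out of `p` lowers the count by at most one, so the strict
-- inequality survives for the rest.
pigeonhole : ∀ {n} (p : Fin n → Bool) (xs : List (Fin n)) → length xs < cnt p → ∃[ i ] p i ≡ true × i ∉ xs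
pigeonhole p []       h with cnt-some p h
... | i , e = i , e , λ ()
pigeonhole p (x ∷ xs) h with pigeonhole (λ i → p i ∧ not (is-x i)) xs
  (+-cancelˡ-< 1 _ _ (<-≤-trans h (≤-trans (cnt-split p is-x) (+-monoˡ-≤ _ (≤-trans (cnt-mono λ i e → proj₂ (∧-true⁻ {p i} e)) (≤-reflexive (unique⇒cnt≡1 is-x x (does-≟-refl x , λ _ → does-≟))))))))
  where
  is-x : Fin _ → Bool
  is-x i = does (i Fin.≟ x)
... | i , e , i∉ with ∧-true⁻ {p i} e
...   | e₁ , e₂ = i , e₁ , λ { (here i≡x) → not-x i i≡x e₂ ; (there m) → i∉ m }
  where
  not-x : ∀ i → i ≡ x → ¬ (not (does (i Fin.≟ x)) ≡ true)
  not-x i i≡x e with i Fin.≟ x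
  ... | no ne = ne i≡x

fibers-bound : ∀ {n} K (τ : Fin n → List Bool) ts (p : Fin n → Bool) → (∀ i → p i ≡ true → τ i ∈ ts) →
               (∀ t → cnt (λ i → p i ∧ (τ i == t)) ≤ K) → cnt p ≤ length ts * K
fibers-bound K τ [] p h b with cnt p in eq
... | zero  = z≤n
... | suc m with cnt-some p (subst (0 <_) (sym eq) (s≤s z≤n))
...   | i , e with () ← h i e
fibers-bound K τ (t ∷ ts) p h b =
  ≤-trans (cnt-split p (λ i → τ i == t)) (+-mono-≤ (b t) (fibers-bound K τ ts (λ i → p i ∧ not (τ i == t)) h′ b′))
  where
  h′ : ∀ i → p i ∧ not (τ i == t) ≡ true → τ i ∈ ts
  h′ i e with ∧-true⁻ {p i} e
  ... | e₁ , e₂ with h i e₁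
  ...   | there m = m
  ...   | here eq with () ← trans (sym e₂) (cong not (trans (cong (_== t) eq) (==-refl t)))
  b′ : ∀ t′ → cnt (λ i → (p i ∧ not (τ i == t)) ∧ (τ i == t′)) ≤ K
  b′ t′ = ≤-trans (cnt-mono λ i e → let e₁ , e₂ = ∧-true⁻ {p i ∧ not (τ i == t)} e in
                   cong₂ _∧_ (proj₁ (∧-true⁻ {p i} e₁)) e₂) (b t′)

room-tabulate : ∀ {n} t (τ : Fin n → List Bool) r → room t (tabulate τ) r ≡ r ∸ cnt (λ i → τ i == t)
room-tabulate {zero}  t τ r = refl
room-tabulate {suc n} t τ r with τ zero == t
... | false = room-tabulate t (τ ∘ suc) r
... | true  = trans (room-tabulate t (τ ∘ suc) (pred r)) (shift r)
  where
  shift : ∀ r → pred r ∸ cnt (λ i → τ (suc i) == t) ≡ r ∸ suc (cnt (λ i → τ (suc i) == t))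
  shift zero    = 0∸n≡0 (cnt (λ i → τ (suc i) == t))
  shift (suc r) = refl

-- Marked vertices of each type

module Marking (K : ℕ) where

  mark : ∀ {n} → (Fin n → List Bool) → (Fin n → Bool) → Fin n → Bool
  mark τ Y zero    = when Y zero then true else positive (K ∸ cnt (λ i → τ (suc i) == τ zero))
  mark τ Y (suc v) = mark (τ ∘ suc) (Y ∘ suc) v

  typesAndMarks-tabulate : ∀ {n} X (r : Fin n → List Bool) (Y : Fin n → Bool) →
    typesAndMarks X K (zip (tabulate r) (tabulate Y)) ≡
    (tabulate (λ v → typ (r v) X) , tabulate (mark (λ v → typ (r v) X) Y))
  typesAndMarks-tabulate {zero}  X r Y = refl
  typesAndMarks-tabulate {suc n} X r Y rewrite typesAndMarks-tabulate X (r ∘ suc) (Y ∘ suc)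
    | room-tabulate (typ (r zero) X) (λ v → typ (r (suc v)) X) K = refl

  mark-Y : ∀ {n} (τ : Fin n → List Bool) Y v → Y v ≡ true → mark τ Y v ≡ true
  mark-Y τ Y zero    e rewrite e = refl
  mark-Y τ Y (suc v) e = mark-Y (τ ∘ suc) (Y ∘ suc) v e

  room-full : ∀ {n} {τ : Fin (suc n) → List Bool} Y → mark τ Y zero ≡ false → K ≤ cnt (λ i → τ (suc i) == τ zero)
  room-full {τ = τ} Y e with Y zero
  ... | false with K ∸ cnt (λ i → τ (suc i) == τ zero) in eq
  ...   | zero = m∸n≡0⇒m≤n eq

  -- A marked first vertex of type `t` raises the right side by one and the minimum by at most one.
  -- An unmarked one already has `K` later vertices of its type, so the minimum equals `K` without
  -- it.
  representatives : ∀ {n} (τ : Fin n → List Bool) Y t →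
                    K ⊓ cnt (λ i → τ i == t) ≤ cnt (λ i → mark τ Y i ∧ (τ i == t))
  representatives {zero}  τ Y t = m⊓n≤n K 0
  representatives {suc n} τ Y t with τ zero == t in eq | mark τ Y zero in em
  ... | false | m    rewrite Bool.∧-zeroʳ m = representatives (τ ∘ suc) (Y ∘ suc) t
  ... | true  | true = ≤-trans (m⊓1+n≤1+m⊓n K _) (s≤s (representatives (τ ∘ suc) (Y ∘ suc) t))
    where
    m⊓1+n≤1+m⊓n : ∀ m n → m ⊓ suc n ≤ suc (m ⊓ n)
    m⊓1+n≤1+m⊓n zero    n = z≤n
    m⊓1+n≤1+m⊓n (suc m) n = s≤s (⊓-monoˡ-≤ n (n≤1+n m))
  ... | true  | false with refl ← ==⇒≡ (τ zero) t eq =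
    ≤-trans (m⊓n≤m K _) (≤-trans (⊓-glb ≤-refl (room-full {τ = τ} Y em)) (representatives (τ ∘ suc) (Y ∘ suc) t))

  many-representatives : ∀ {n} (τ : Fin n → List Bool) Y v → mark τ Y v ≡ false →
                         K ≤ cnt (λ i → mark τ Y i ∧ (τ i == τ v))
  many-representatives τ Y v e =
    ≤-trans (⊓-glb ≤-refl (many τ Y v e)) (representatives τ Y (τ v))
    where
    many : ∀ {n} (τ : Fin n → List Bool) Y v → mark τ Y v ≡ false → K ≤ cnt (λ i → τ i == τ v)
    many τ Y zero    e = ≤-trans (room-full {τ = τ} Y e) (cnt-tail (λ i → τ i == τ zero))
    many τ Y (suc v) e = ≤-trans (many (τ ∘ suc) (Y ∘ suc) v e) (cnt-tail (λ i → τ i == τ (suc v)))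

  -- The first vertex counted was marked because fewer than `K` later vertices share its type.
  few-per-type : ∀ {n} (τ : Fin n → List Bool) Y t → cnt (λ i → (mark τ Y i ∧ not (Y i)) ∧ (τ i == t)) ≤ K
  few-per-type {zero}  τ Y t = z≤n
  few-per-type {suc n} τ Y t with Y zero
  few-per-type {suc n} τ Y t | true  = few-per-type (τ ∘ suc) (Y ∘ suc) t
  few-per-type {suc n} τ Y t | false with K ∸ cnt (λ i → τ (suc i) == τ zero) in er | τ zero == t in eq
  ... | zero  | _     = few-per-type (τ ∘ suc) (Y ∘ suc) t
  ... | suc r | false = few-per-type (τ ∘ suc) (Y ∘ suc) t
  ... | suc r | true  with refl ← ==⇒≡ (τ zero) t eq =
    ≤-trans (s≤s (cnt-mono λ i e → proj₂ (∧-true⁻ {mark (τ ∘ suc) (Y ∘ suc) i ∧ not (Y (suc i))} e)))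
      (m∸n≢0⇒n<m λ z → contradiction (trans (sym er) z) λ ())

  allTypes : ∀ {n} → (Fin n → Bool) → List (List Bool)
  allTypes {zero}  Y = [] ∷ []
  allTypes {suc n} Y = map (false ∷_) (allTypes (Y ∘ suc)) ++ (when Y zero then map (true ∷_) (allTypes (Y ∘ suc)) else [])

  length-allTypes : ∀ {n} (Y : Fin n → Bool) → length (allTypes Y) ≡ 2 ^ cnt Y
  length-allTypes {zero}  Y = refl
  length-allTypes {suc n} Y with Y zero
  ... | false = trans (length-++ (map (false ∷_) (allTypes (Y ∘ suc)))) (trans (+-identityʳ _) (trans (length-map _ (allTypes (Y ∘ suc))) (length-allTypes (Y ∘ suc))))
  ... | true  = trans (length-++ (map (false ∷_) (allTypes (Y ∘ suc))))
                  (cong₂ _+_ (trans (length-map _ (allTypes (Y ∘ suc))) (length-allTypes (Y ∘ suc)))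
                    (trans (length-map _ (allTypes (Y ∘ suc))) (trans (length-allTypes (Y ∘ suc)) (sym (+-identityʳ _)))))

  typ∈allTypes : ∀ {n} (a Y : Fin n → Bool) → typ (tabulate a) (tabulate Y) ∈ allTypes Y
  typ∈allTypes {zero}  a Y = here refl
  typ∈allTypes {suc n} a Y with a zero | Y zero
  ... | false | _     = ∈-++⁺ˡ (∈-map⁺ (false ∷_) (typ∈allTypes (a ∘ suc) (Y ∘ suc)))
  ... | true  | false = ∈-++⁺ˡ (∈-map⁺ (false ∷_) (typ∈allTypes (a ∘ suc) (Y ∘ suc)))
  ... | true  | true  = ∈-++⁺ʳ (map (false ∷_) (allTypes (Y ∘ suc))) (∈-map⁺ (true ∷_) (typ∈allTypes (a ∘ suc) (Y ∘ suc)))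

  few-marked : ∀ {n} (r : Fin n → Fin n → Bool) Y → let τ = λ v → typ (tabulate (r v)) (tabulate Y) in
               cnt (mark τ Y) ≤ cnt Y + 2 ^ cnt Y * K
  few-marked r Y = begin
    cnt (mark τ Y)                                                              ≤⟨ cnt-split (mark τ Y) Y ⟩
    cnt (λ i → mark τ Y i ∧ Y i) + cnt (λ i → mark τ Y i ∧ not (Y i))           ≤⟨ +-mono-≤ (cnt-mono λ i e → proj₂ (∧-true⁻ {mark τ Y i} e))
                                                                                     (fibers-bound K τ (allTypes Y) _ (λ i _ → typ∈allTypes (r i) Y) (few-per-type τ Y)) ⟩
    cnt Y + length (allTypes Y) * K                                             ≡⟨ cong (λ z → cnt Y + z * K) (length-allTypes Y) ⟩
    cnt Y + 2 ^ cnt Y * K                                                       ∎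
    where
    open ≤-Reasoning
    τ = λ v → typ (tabulate (r v)) (tabulate Y)

-- Conflict-freeness of tabulated colorings

_==ℕ_ : ℕ → ℕ → Bool
c ==ℕ x = replicate c false == replicate x false

==ℕ⇒≡ : ∀ c x → (c ==ℕ x) ≡ true → c ≡ x
==ℕ⇒≡ zero    zero    _ = refl
==ℕ⇒≡ (suc c) (suc x) h = cong suc (==ℕ⇒≡ c x h)

==ℕ-refl : ∀ c → (c ==ℕ c) ≡ true
==ℕ-refl c = ==-refl (replicate c false)

count-tabulate : ∀ {n} c (a : Fin n → Bool) (C : Fin n → ℕ) →
                 count c (zip (tabulate a) (tabulate C)) ≡ cnt (λ u → a u ∧ (c ==ℕ C u))
count-tabulate {zero}  c a C = refl
count-tabulate {suc n} c a C with a zero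
... | false = count-tabulate c (a ∘ suc) (C ∘ suc)
... | true with c ==ℕ C zero
...   | true  = cong suc (count-tabulate c (a ∘ suc) (C ∘ suc))
...   | false = count-tabulate c (a ∘ suc) (C ∘ suc)

isOne⁻ : ∀ m → isOne m ≡ true → m ≡ 1
isOne⁻ (suc zero) _ = refl

any-foldl⁻ : ∀ {A : Set} (p : A → Bool) acc xs → foldl (λ acc c → when p c then true else acc) acc xs ≡ true →
             acc ≡ true ⊎ ∃[ x ] x ∈ xs × p x ≡ true
any-foldl⁻ p acc []       h = inj₁ h
any-foldl⁻ p acc (x ∷ xs) h with any-foldl⁻ p _ xs h
... | inj₂ (y , m , e) = inj₂ (y , there m , e)
... | inj₁ e with p x in eq
...   | true  = inj₂ (x , here refl , eq)
...   | false = inj₁ e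

any-foldl⁺ : ∀ {A : Set} (p : A → Bool) acc xs {x} → x ∈ xs → p x ≡ true →
             foldl (λ acc c → when p c then true else acc) acc xs ≡ true
any-foldl⁺ p acc (x ∷ xs) (there m)   e = any-foldl⁺ p _ xs m e
any-foldl⁺ p acc (x ∷ xs) (here refl) e rewrite e = stays xs
  where
  stays : ∀ xs → foldl (λ acc c → when p c then true else acc) true xs ≡ true
  stays []       = refl
  stays (y ∷ xs) with p y
  ... | true  = stays xs
  ... | false = stays xs

all-foldl⁻ : ∀ {A : Set} (p : A → Bool) acc xs → foldl (λ acc x → when p x then acc else false) acc xs ≡ true →
             acc ≡ true × (∀ {x} → x ∈ xs → p x ≡ true)
all-foldl⁻ p acc []       h = h , λ ()
all-foldl⁻ p acc (x ∷ xs) h with all-foldl⁻ p _ xs h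
... | e , f with p x in eq
...   | true  = e , λ { (here refl) → eq ; (there m) → f m }
...   | false with () ← e

all-foldl⁺ : ∀ {A : Set} (p : A → Bool) xs → (∀ {x} → x ∈ xs → p x ≡ true) →
             foldl (λ acc x → when p x then acc else false) true xs ≡ true
all-foldl⁺ p []       h = refl
all-foldl⁺ p (x ∷ xs) h rewrite h (here refl) = all-foldl⁺ p xs (h ∘ there)

∣∩∣≡cnt : ∀ {m} (a b : Fin m → Bool) → ∣ Vec.tabulate a ∩ Vec.tabulate b ∣ ≡ cnt (λ u → a u ∧ b u)
∣∩∣≡cnt {zero}  a b = refl
∣∩∣≡cnt {suc m} a b with a zero ∧ b zero
... | true  = cong suc (∣∩∣≡cnt (a ∘ suc) (b ∘ suc))
... | false = ∣∩∣≡cnt (a ∘ suc) (b ∘ suc)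

rows : ∀ {n} → Graph n → List (List Bool)
rows G = tabulate λ v → tabulate (Graph.adj G v)

module _ {n} (G : Graph n) where
  open Graph G using (adj; Adj)

  -- The witness is a vertex instead of a color, so it can be kept, or moved by a permutation, while
  -- colors are renamed.
  Sees : (Fin n → ℕ) → Fin n → Fin n → Set
  Sees C v y = Adj v y × (∀ z → Adj v z → C z ≡ C y → z ≡ y)

  Valid : (Fin n → ℕ) → Set
  Valid C = ∀ v → ∃[ y ] Sees C v y

  sees⇒unique : ∀ C v y → Sees C v y → Unique (λ u → adj v u ∧ (C y ==ℕ C u)) y
  sees⇒unique C v y (a , u) = cong₂ _∧_ a (==ℕ-refl (C y)) , λ z e →
    let e₁ , e₂ = ∧-true⁻ {adj v z} e in u z e₁ (sym (==ℕ⇒≡ (C y) (C z) e₂))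

  unique⇒sees : ∀ C v c y → Unique (λ u → adj v u ∧ (c ==ℕ C u)) y → Sees C v y
  unique⇒sees C v c y (e , u) with ∧-true⁻ {adj v y} e
  ... | e₁ , e₂ with refl ← ==ℕ⇒≡ c (C y) e₂ =
    e₁ , λ z a eq → u z (cong₂ _∧_ a (subst (λ x → (C y ==ℕ x) ≡ true) (sym eq) (==ℕ-refl (C y))))

  check⇒valid : ∀ C → check (tabulate C) (rows G) ≡ true → Valid C
  check⇒valid C h v with any-foldl⁻ _ false (tabulate C) (proj₂ (all-foldl⁻ (λ row → rowOK row (tabulate C)) true (rows G) h) (∈-tabulate⁺ v))
  ... | inj₂ (c , m , e) with cnt≡1⇒unique (λ u → adj v u ∧ (c ==ℕ C u)) (trans (sym (count-tabulate c (adj v) C)) (isOne⁻ _ e))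
  ...   | y , u = y , unique⇒sees C v c y u

  valid⇒check : ∀ C → Valid C → check (tabulate C) (rows G) ≡ true
  valid⇒check C V = all-foldl⁺ (λ row → rowOK row (tabulate C)) (rows G) row-ok
    where
    row-ok : ∀ {row} → row ∈ rows G → rowOK row (tabulate C) ≡ true
    row-ok m with ∈-tabulate⁻ m
    ... | v , refl with V v
    ...   | y , s = any-foldl⁺ _ false (tabulate C) (∈-tabulate⁺ y)
            (cong isOne (trans (count-tabulate (C y) (adj v) C) (unique⇒cnt≡1 _ y (sees⇒unique C v y s))))

  valid⇒CFON : ∀ {k} (C : Coloring n k) → Valid (toℕ ∘ C) → IsCFON G C
  valid⇒CFON C V v with V v
  ... | y , a , u = C y , trans (∣∩∣≡cnt (adj v) (λ w → does (C w Fin.≟ C y)))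
    (unique⇒cnt≡1 _ y (cong₂ _∧_ a (does-≟-refl (C y)) , λ z e →
      let e₁ , e₂ = ∧-true⁻ {adj v z} e in u z e₁ (cong toℕ (does-≟ {c = C z} {C y} e₂))))

  CFON⇒valid : ∀ {k} (C : Coloring n k) → IsCFON G C → Valid (toℕ ∘ C)
  CFON⇒valid C H v with H v
  ... | c , e with cnt≡1⇒unique _ (trans (sym (∣∩∣≡cnt (adj v) (λ w → does (C w Fin.≟ c)))) e)
  ...   | y , e′ , u with ∧-true⁻ {adj v y} e′
  ...     | e₁ , e₂ with refl ← does-≟ {c = C y} {c} e₂ = y , e₁ , λ z a eq →
    u z (cong₂ _∧_ a (subst (λ x → does (x Fin.≟ C y) ≡ true) (sym (Fin.toℕ-injective eq)) (does-≟-refl (C y))))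

  Found : ℕ → List ℕ → Set
  Found k s = ∃[ C ] s ≡ tabulate C × Valid C × (∀ v → C v ≤ k)

-- Invariants of the search

foldl-preserves : ∀ {A B : Set} (P : B → Set) {f : B → A → B} xs → (∀ {x} b → x ∈ xs → P b → P (f b x)) →
                  ∀ b → P b → P (foldl f b xs)
foldl-preserves P []       h b p = p
foldl-preserves P (x ∷ xs) h b p = foldl-preserves P xs (λ b m → h b (there m)) _ (h b (here refl) p)

foldl-establishes : ∀ {A B : Set} (P : B → Set) {f : B → A → B} xs → (∀ {x} b → x ∈ xs → P b → P (f b x)) →
                    ∀ {x} → x ∈ xs → (∀ b → P (f b x)) → ∀ b → P (foldl f b xs)
foldl-establishes P (x ∷ xs) h (here refl) e b = foldl-preserves P xs (λ b m → h b (there m)) _ (e b)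
foldl-establishes P (x ∷ xs) h (there m)   e b = foldl-establishes P xs (λ b m → h b (there m)) m e _

tabulate-exists : ∀ {A : Set} {n} (s : List A) → length s ≡ n → ∃[ C ] s ≡ tabulate {n = n} C
tabulate-exists s refl = List.lookup s , sym (tabulate-lookup s)

-- The characteristic function of `x` with `u` added, by a recursion that parallels `plantStep`.
plant : ∀ {n} → (Fin n → Bool) → Fin n → Fin n → Bool
plant x zero    zero    = true
plant x zero    (suc v) = x (suc v)
plant x (suc u) zero    = x zero
plant x (suc u) (suc v) = plant (x ∘ suc) u v

plant∈plants : ∀ {n} (x : Fin n → Bool) u → tabulate (plant x u) ∈ plants (tabulate x)
plant∈plants x zero    = subst (λ z → (true ∷ z) ∈ plants (tabulate x)) (proj₁-suffixAndPlants (tabulate (x ∘ suc))) (∈-prepend⁺ˡ _ (plants (tabulate (x ∘ suc))) (here refl))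
plant∈plants x (suc u) = ∈-prepend⁺ʳ _ (plants (tabulate (x ∘ suc))) (plant∈plants (x ∘ suc) u)

∈plants⇒plant : ∀ {n Y} (x : Fin n → Bool) → Y ∈ plants (tabulate x) → ∃[ u ] Y ≡ tabulate (plant x u)
∈plants⇒plant {suc n} x m with ∈-plants⁻ (x zero) (tabulate (x ∘ suc)) m
... | inj₁ refl = zero , refl
... | inj₂ (Z , m , refl) with ∈plants⇒plant (x ∘ suc) m
...   | u , refl = suc u , refl

plant-self : ∀ {n} (x : Fin n → Bool) u → plant x u u ≡ true
plant-self x zero    = refl
plant-self x (suc u) = plant-self (x ∘ suc) u

plant-⊇ : ∀ {n} (x : Fin n → Bool) u v → x v ≡ true → plant x u v ≡ true
plant-⊇ x zero    zero    e = refl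
plant-⊇ x zero    (suc v) e = e
plant-⊇ x (suc u) zero    e = e
plant-⊇ x (suc u) (suc v) e = plant-⊇ (x ∘ suc) u v e

cnt-plant : ∀ {n} (x : Fin n → Bool) u → cnt (plant x u) ≤ suc (cnt x)
cnt-plant x zero with x zero
... | true  = n≤1+n _
... | false = ≤-refl
cnt-plant x (suc u) with x zero
... | true  = s≤s (cnt-plant (x ∘ suc) u)
... | false = cnt-plant (x ∘ suc) u

module _ {n} (G : Graph n) (x : Fin n → Bool) where

  private
    K = budget (tabulate x)

  open Marking K

  cand-colors : ∀ {Y k s} → Y ∈ plants (tabulate x) → s ∈ cands (downFrom (suc k)) (marks (rows G) Y K) →
                ∃[ C ] s ≡ tabulate {n = n} C × (∀ v → C v ≤ k)
  cand-colors {Y} {k} {s} m m′ with tabulate-exists s (trans (sym (Pointwise-length (∈-cands⁻ (marks (rows G) Y K) m′)))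
      (trans (length-marks (rows G) Y Y K (trans (length-tabulate {n = n} _) (sym hY))) hY))
    where
    hY : length Y ≡ n
    hY = trans (plants-length (tabulate x) m) (length-tabulate x)
  ... | C , refl = C , refl , tabulate⁻ (cands-bounded (marks (rows G) Y K) m′)

  keep-preserves : ∀ {k j s best} → s ≡ tabulate {n = n} j → (∀ v → j v ≤ k) → Found G k best → Found G k (keep (rows G) best s)
  keep-preserves {j = C} refl b f with check (tabulate C) (rows G) in eq
  ... | true  = C , refl , check⇒valid G C eq , b
  ... | false = f

  level-preserves : ∀ {k k′ best} → k′ ≤ k → Found G k best → Found G k (level (rows G) (tabulate x) K best k′)
  level-preserves {k} {k′} k′≤k = foldl-preserves (Found G k) (plants (tabulate x)) (λ {Y} best m →
    foldl-preserves (Found G k) (cands (downFrom (suc k′)) (marks (rows G) Y K)) (λ best m′ f →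
      let C , e , b = cand-colors m m′ in keep-preserves e (λ v → ≤-trans (b v) k′≤k) f) best) _

  -- At level `k` the coloring `C` is itself a candidate and passes the check, whatever the higher
  -- levels left behind. From then on the current best is replaced only by checked candidates with
  -- colors at most `k`.
  search-found : ∀ {k} u C → k ≤ K → Valid G C → (∀ v → C v ≤ k) →
                 (∀ v → mark (λ v → typ (tabulate (Graph.adj G v)) (tabulate (plant x u))) (plant x u) v ≡ false → C v ≡ 0) →
                 Found G k (search (rows G) (tabulate x))
  search-found {k} u C k≤K V b z = descend K k≤K []
    where
    Y = tabulate (plant x u)
    C∈cands : tabulate C ∈ cands (downFrom (suc k)) (marks (rows G) Y K)
    C∈cands rewrite typesAndMarks-tabulate Y (λ v → tabulate (Graph.adj G v)) (plant x u) =
      ∈-cands⁺ _ (Pointwise.tabulate⁺ λ v → b v , z v)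
    kept : ∀ best → Found G k (keep (rows G) best (tabulate C))
    kept best rewrite valid⇒check G C V = C , refl , V , b
    level-establishes : ∀ best → Found G k (level (rows G) (tabulate x) K best k)
    level-establishes = foldl-establishes (Found G k) (plants (tabulate x)) (λ {Y} best m →
      foldl-preserves (Found G k) (cands (downFrom (suc k)) (marks (rows G) Y K)) (λ best m′ f →
        let C , e , b = cand-colors m m′ in keep-preserves e b f) best)
      (plant∈plants x u) (λ best → foldl-establishes (Found G k) (cands (downFrom (suc k)) (marks (rows G) Y K)) (λ best m′ f →
        let C , e , b = cand-colors (plant∈plants x u) m′ in keep-preserves e b f) C∈cands kept best)
    descend : ∀ K′ → k ≤ K′ → ∀ best → Found G k (foldl (level (rows G) (tabulate x) K) best (downFrom (suc K′)))
    descend K′ k≤K′ best with m≤n⇒m<n∨m≡n k≤K′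
    descend (suc K′) _ best | inj₁ (s≤s k≤K′) = descend K′ k≤K′ _
    descend K′       _ best | inj₂ refl = foldl-preserves (Found G k) (downFrom K′)
      (λ best m → level-preserves (<⇒≤ (∈-downFrom⁻ m))) _ (level-establishes best)

-- Hubs and recoloring

¬true⇒false : ∀ {b} → ¬ b ≡ true → b ≡ false
¬true⇒false {true}  h = contradiction refl h
¬true⇒false {false} h = refl

-- The hub is the universal vertex added last, or the starting vertex if there is none: all later
-- vertices are added as isolated ones and stay isolated.
threshold-hub : ∀ {n} {G : Graph n} → Threshold G →
                ∃[ u ] ∀ v → v ≢ u → Graph.Adj G v u ⊎ Isolated G v
threshold-hub (single G) = zero , λ { zero ne → contradiction refl ne }
threshold-hub (addUniversal G v uni _) = v , λ w ne → inj₁ (trans (Graph.sym G w v) (uni w ne))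
threshold-hub (addIsolated G v iso T) with threshold-hub T
... | u , h = punchIn v u , other
  where
  other : ∀ w → w ≢ punchIn v u → Graph.Adj G w (punchIn v u) ⊎ Isolated G w
  other w ne with v Fin.≟ w
  ... | yes refl = inj₂ iso
  ... | no v≢w with h (punchOut v≢w) (λ e → ne (trans (sym (Fin.punchIn-punchOut v≢w)) (cong (punchIn v) e)))
  ...   | inj₁ a = inj₁ (subst (λ z → Graph.Adj G z (punchIn v u)) (Fin.punchIn-punchOut v≢w) a)
  ...   | inj₂ i = inj₂ no-neighbor
    where
    no-neighbor : Isolated G w
    no-neighbor x a with v Fin.≟ x
    ... | yes refl = iso w (trans (Graph.sym G v w) a)
    ... | no v≢x = i (punchOut v≢x)
      (subst₂ (Graph.Adj G) (sym (Fin.punchIn-punchOut v≢w)) (sym (Fin.punchIn-punchOut v≢x)) a)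

element-surjective : ∀ {n} (S : Subset n) v → Vec.lookup S v ≡ true → ∃[ i ] element S i ≡ v
element-surjective (inside  Vec.∷ S) zero    e = zero , refl
element-surjective (inside  Vec.∷ S) (suc v) e with element-surjective S v e
... | i , eq = suc i , cong suc eq
element-surjective (outside Vec.∷ S) (suc v) e with element-surjective S v e
... | i , eq = i , cong suc eq

lookup-∁ : ∀ {n} (X : Subset n) v → Vec.lookup X v ≡ false → Vec.lookup (∁ X) v ≡ true
lookup-∁ (outside Vec.∷ X) zero    e = refl
lookup-∁ (_       Vec.∷ X) (suc v) e = lookup-∁ X v e

elements : ∀ {n} → (Fin n → Bool) → List (Fin n)
elements {zero}  p = []
elements {suc n} p = when p zero then zero ∷ map suc (elements (p ∘ suc)) else map suc (elements (p ∘ suc))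

length-elements : ∀ {n} (p : Fin n → Bool) → length (elements p) ≡ cnt p
length-elements {zero}  p = refl
length-elements {suc n} p with p zero
... | true  = cong suc (trans (length-map suc (elements (p ∘ suc))) (length-elements (p ∘ suc)))
... | false = trans (length-map suc (elements (p ∘ suc))) (length-elements (p ∘ suc))

∈-elements⁺ : ∀ {n} (p : Fin n → Bool) v → p v ≡ true → v ∈ elements p
∈-elements⁺ p zero    e rewrite e = here refl
∈-elements⁺ p (suc v) e with p zero
... | true  = there (∈-map⁺ suc (∈-elements⁺ (p ∘ suc) v e))
... | false = ∈-map⁺ suc (∈-elements⁺ (p ∘ suc) v e)

∈-elements⁻ : ∀ {n} (p : Fin n → Bool) {v} → v ∈ elements p → p v ≡ true
∈-elements⁻ {suc n} p m with p zero in eq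
∈-elements⁻ {suc n} p (here refl) | true = eq
∈-elements⁻ {suc n} p (there m)   | true with ∈-map⁻ suc m
... | v , m′ , refl = ∈-elements⁻ (p ∘ suc) m′
∈-elements⁻ {suc n} p m | false with ∈-map⁻ suc m
... | v , m′ , refl = ∈-elements⁻ (p ∘ suc) m′

-- The position of v in xs, or length xs if v ∉ xs.
index : ∀ {n} → List (Fin n) → Fin n → ℕ
index []       v = 0
index (x ∷ xs) v with v Fin.≟ x
... | yes _ = 0
... | no _  = suc (index xs v)

index≤ : ∀ {n} xs (v : Fin n) → index xs v ≤ length xs
index≤ []       v = z≤n
index≤ (x ∷ xs) v with v Fin.≟ x
... | yes _ = z≤n
... | no _  = s≤s (index≤ xs v)

index-injective : ∀ {n} xs (v w : Fin n) → v ∈ xs → index xs w ≡ index xs v → w ≡ v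
index-injective (x ∷ xs) v w m e with v Fin.≟ x | w Fin.≟ x
index-injective (x ∷ xs) v w m           e | yes refl | yes refl = refl
index-injective (x ∷ xs) v w (here refl) e | no ne    | _        = contradiction refl ne
index-injective (x ∷ xs) v w (there m)   e | no _     | no _     = index-injective xs v w m (suc-injective e)

-- All that the recoloring uses about `G`: connectedness survives only as the absence of isolated
-- vertices, and the threshold structure only as `outer`.
record Modulator {n} (G : Graph n) (Y : Fin n → Bool) (hub : Fin n) : Set where
  open Graph G using (Adj)
  field
    neighbor : ∀ v → ∃[ w ] Adj v w
    hub∈     : Y hub ≡ true
    outer    : ∀ v → Y v ≡ false → Adj v hub ⊎ (∀ w → Adj v w → Y w ≡ true)

threshold-modulator : ∀ {n} (G : Graph n) (X : Subset n) → 2 ≤ n → Connected G → Threshold (G ∖ X) →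
                      ∃[ u ] Modulator G (plant (Vec.lookup X) u) u
threshold-modulator {suc zero} G X (s≤s ())
threshold-modulator {suc (suc n)} G X (s≤s (s≤s z≤n)) conn T with threshold-hub T
... | i , h = u , record { neighbor = neighbor ; hub∈ = plant-self x u ; outer = outer }
  where
  open Graph G using (Adj)
  x = Vec.lookup X
  u = element (∁ X) i
  first-step : ∀ {v w} → v ≢ w → Star Adj v w → ∃[ z ] Adj v z
  first-step ne ε       = contradiction refl ne
  first-step ne (a ◅ _) = _ , a
  neighbor : ∀ v → ∃[ w ] Adj v w
  neighbor zero    = first-step (λ ()) (conn zero (suc zero))
  neighbor (suc v) = first-step (λ ()) (conn (suc v) zero)
  outside-X : ∀ v → plant x u v ≡ false → x v ≡ false
  outside-X v e = ¬true⇒false λ e′ → contradiction (trans (sym (plant-⊇ x u v e′)) e) λ ()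
  outer : ∀ v → plant x u v ≡ false → Adj v u ⊎ (∀ w → Adj v w → plant x u w ≡ true)
  outer v e with element-surjective (∁ X) v (lookup-∁ X v (outside-X v e))
  ... | j , refl with h j (λ { refl → contradiction (trans (sym (plant-self x u)) e) λ () })
  ...   | inj₁ a   = inj₁ a
  ...   | inj₂ iso = inj₂ all-inside
    where
    all-inside : ∀ w → Adj v w → plant x u w ≡ true
    all-inside w a with plant x u w in eq
    ... | true  = refl
    ... | false with element-surjective (∁ X) w (lookup-∁ X w (outside-X w eq))
    ...   | k , refl = contradiction a (iso k)

typ-agree : ∀ {n} (a b Y : Fin n → Bool) → typ (tabulate a) (tabulate Y) ≡ typ (tabulate b) (tabulate Y) →
            ∀ x → Y x ≡ true → a x ≡ b x
typ-agree {suc n} a b Y e zero    y = entry (a zero) (b zero) (∷-injectiveˡ e)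
  where
  entry : ∀ p q → (when p then Y zero else false) ≡ (when q then Y zero else false) → p ≡ q
  entry true  true  _ = refl
  entry false false _ = refl
  entry true  false e = contradiction (trans (sym y) e) λ ()
  entry false true  e = contradiction (trans (sym y) (sym e)) λ ()
typ-agree {suc n} a b Y e (suc x) y = typ-agree (a ∘ suc) (b ∘ suc) (Y ∘ suc) (∷-injectiveʳ e) x y

-- Recoloring with two extra colors, and existence of the minimum

module _ {n} (G : Graph n) where
  open Graph G using (adj; Adj)

  module _ {Y : Fin n → Bool} {hub : Fin n} (M : Modulator G Y hub) where
    open Modulator M

    -- Private colors go to the vertices of `Y` and to one neighbor of each, and all others share
    -- one color. Every vertex has a privately colored neighbor: the chosen one, the hub, or one in
    -- `Y`. This bounds χ by 2|Y| + 1.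
    few-colors-suffice : ∃[ C ] Valid G C × (∀ v → C v ≤ cnt Y + cnt Y)
    few-colors-suffice = index L , valid , λ v → ≤-trans (index≤ L v) (≤-reflexive length-L)
      where
      p : Fin n → Fin n
      p v = proj₁ (neighbor v)
      L = elements Y ++ map p (elements Y)
      length-L : length L ≡ cnt Y + cnt Y
      length-L = trans (length-++ (elements Y))
        (cong₂ _+_ (length-elements Y) (trans (length-map p (elements Y)) (length-elements Y)))
      valid-by : ∀ {v} y → Adj v y → y ∈ L → ∃[ y ] Sees G (index L) v y
      valid-by y a m = y , a , λ z _ e → index-injective L y z m e
      valid : Valid G (index L)
      valid v with Y v in eq
      ... | true  = valid-by (p v) (proj₂ (neighbor v)) (∈-++⁺ʳ (elements Y) (∈-map⁺ p (∈-elements⁺ Y v eq)))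
      ... | false with outer v eq
      ...   | inj₁ a = valid-by hub a (∈-++⁺ˡ (∈-elements⁺ Y hub hub∈))
      ...   | inj₂ h = valid-by (p v) (proj₂ (neighbor v)) (∈-++⁺ˡ (∈-elements⁺ Y (p v) (h _ (proj₂ (neighbor v)))))

    module _ {χ} (C : Fin n → ℕ) (V : Valid G C) (C<χ : ∀ v → C v < χ) where

      -- The shift by one frees 0 for the dummies, and `suc χ` lies above every shifted color.
      base : Fin n → ℕ
      base v with v Fin.≟ hub
      ... | yes _ = suc χ
      ... | no _  = suc (C v)

      base≤ : ∀ v → base v ≤ suc χ
      base≤ v with v Fin.≟ hub
      ... | yes _ = ≤-refl
      ... | no _  = s≤s (<⇒≤ (C<χ v))

      base-hub : base hub ≡ suc χ
      base-hub with hub Fin.≟ hub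
      ... | yes _ = refl
      ... | no ne = contradiction refl ne

      -- Vertices with equal `base` colors are both the hub or had equal colors under `C`, so a
      -- neighbor with a unique color keeps a unique color.
      base-sees : ∀ {v y z} → Sees G C v y → Adj v z → base z ≡ base y → z ≡ y
      base-sees {y = y} {z} (_ , u) a e with z Fin.≟ hub | y Fin.≟ hub
      ... | yes refl | yes refl = refl
      ... | yes _    | no _     = contradiction (suc-injective (sym e)) (<⇒≢ (C<χ y))
      ... | no _     | yes _    = contradiction (suc-injective e) (<⇒≢ (C<χ z))
      ... | no _     | no _     = u z a (suc-injective e)

      base-unique-hub : ∀ {v} → base v ≡ suc χ → v ≡ hub
      base-unique-hub {v} e with v Fin.≟ hub
      ... | yes r = r
      ... | no _  = contradiction (suc-injective e) (<⇒≢ (C<χ v))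

      -- The part of validity that must be carried through the exchanges of colors: only vertices of
      -- `Y` need a witness, and `offY` reserves `suc χ` for the hub.
      record Good (D : Fin n → ℕ) : Set where
        field
          sees : ∀ v → Y v ≡ true → ∃[ y ] Sees G D v y
          onY  : ∀ v → Y v ≡ true → D v ≡ base v
          offY : ∀ v → Y v ≡ false → D v ≤ χ

      good-bound : ∀ {D} → Good D → ∀ v → D v ≤ suc χ
      good-bound g v with Y v in eq
      ... | true  = ≤-trans (≤-reflexive (Good.onY g v eq)) (base≤ v)
      ... | false = m≤n⇒m≤1+n (Good.offY g v eq)

      -- Outside `Y`, a neighbor of the hub sees the only vertex of color `suc χ`; any other vertex
      -- has its whole neighborhood in `Y`, where `D` agrees with `base`, and keeps its witness from
      -- `V`.
      good⇒valid : ∀ {D} → Good D → Valid G D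
      good⇒valid {D} g v with Y v in eq
      ... | true = Good.sees g v eq
      ... | false with outer v eq
      ...   | inj₁ a = hub , a , λ z _ e → hub-only z (trans e (trans (Good.onY g hub hub∈) base-hub))
        where
        hub-only : ∀ z → D z ≡ suc χ → z ≡ hub
        hub-only z e with Y z in ez
        ... | true  = base-unique-hub (trans (sym (Good.onY g z ez)) e)
        ... | false = contradiction (≤-trans (≤-reflexive (sym e)) (Good.offY g z ez)) (<-irrefl refl)
      ...   | inj₂ h with V v
      ...     | y , s@(a , _) = y , a , λ z a′ e →
        base-sees s a′ (trans (sym (Good.onY g z (h z a′))) (trans e (Good.onY g y (h y a))))

      representative : Fin n → Fin n
      representative v = proj₁ (V v)

      chosen? : ∀ v → Dec (Y v ≡ true ⊎ v ∈ map representative (elements Y))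
      chosen? v with Y v Bool.≟ true
      ... | yes e = yes (inj₁ e)
      ... | no ne = map′ inj₂ (λ { (inj₁ e) → contradiction e ne ; (inj₂ m) → m }) (any? (v Fin.≟_) (map representative (elements Y)))

      start : Fin n → ℕ
      start v with chosen? v
      ... | yes _ = base v
      ... | no _  = 0

      start-chosen : ∀ {v} → Y v ≡ true ⊎ v ∈ map representative (elements Y) → start v ≡ base v
      start-chosen {v} c with chosen? v
      ... | yes _ = refl
      ... | no ¬c = contradiction c ¬c

      base≢0 : ∀ v → base v ≢ 0
      base≢0 v e with v Fin.≟ hub
      base≢0 v () | yes _
      base≢0 v () | no _

      start-good : Good start
      start-good = record
        { sees = λ v e → let s = proj₂ (V v) ; c = inj₂ (∈-map⁺ representative (∈-elements⁺ Y v e)) in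
            representative v , proj₁ s , λ z a eq → sees-start s a (trans eq (start-chosen c))
        ; onY = λ v e → start-chosen (inj₁ e)
        ; offY = off }
        where
        sees-start : ∀ {v y z} → Sees G C v y → Adj v z → start z ≡ base y → z ≡ y
        sees-start {y = y} {z} s a e with chosen? z
        ... | yes _ = base-sees s a e
        ... | no _  = contradiction (sym e) (base≢0 y)
        off : ∀ v → Y v ≡ false → start v ≤ χ
        off v e with chosen? v
        ... | no _ = z≤n
        ... | yes _ with v Fin.≟ hub
        ...   | no _     = C<χ v
        ...   | yes refl = contradiction (trans (sym e) hub∈) λ ()

      start-support : ∀ v → start v ≢ 0 → v ∈ elements Y ⊎ v ∈ map representative (elements Y)
      start-support v ne with chosen? v
      ... | yes (inj₁ e) = inj₁ (∈-elements⁺ Y v e)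
      ... | yes (inj₂ m) = inj₂ m
      ... | no _         = contradiction refl ne

      τ : Fin n → List Bool
      τ v = typ (tabulate (adj v)) (tabulate Y)

      transpose-fixes : ∀ {a b v : Fin n} → v ≢ a → v ≢ b → transpose a b v ≡ v
      transpose-fixes {a} {b} {v} va vb with v Fin.≟ a
      ... | yes e = contradiction e va
      ... | no _ with v Fin.≟ b
      ...   | yes e = contradiction e vb
      ...   | no _  = refl

      -- Equal types mean that each vertex of `Y` is adjacent to both or neither of `a` and `b`, so
      -- the transposition maps its neighborhood onto itself.
      swap-good : ∀ {D} a b → Y a ≡ false → Y b ≡ false → τ b ≡ τ a → Good D → Good (D ∘ transpose a b)
      swap-good {D} a b ya yb t g = record
        { sees = sees′
        ; onY  = λ v e → trans (cong D (transpose-fixes (apart e ya) (apart e yb))) (Good.onY g v e)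
        ; offY = off }
        where
        apart : ∀ {v w} → Y v ≡ true → Y w ≡ false → v ≢ w
        apart e e′ refl = contradiction (trans (sym e) e′) λ ()
        same : ∀ v → Y v ≡ true → adj v a ≡ adj v b
        same v e = trans (Graph.sym G v a) (trans (sym (typ-agree (adj b) (adj a) Y t v e)) (Graph.sym G b v))
        adj-transpose : ∀ v z → Y v ≡ true → adj v (transpose a b z) ≡ adj v z
        adj-transpose v z e with z Fin.≟ a
        ... | yes refl = sym (same v e)
        ... | no _ with z Fin.≟ b
        ...   | yes refl = same v e
        ...   | no _     = refl
        adj-transpose′ : ∀ v z → Y v ≡ true → adj v (transpose b a z) ≡ adj v z
        adj-transpose′ v z e = trans (sym (adj-transpose v (transpose b a z) e)) (cong (adj v) (transpose-inverse a b))
        sees′ : ∀ v → Y v ≡ true → ∃[ y ] Sees G (D ∘ transpose a b) v y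
        sees′ v e with Good.sees g v e
        -- The witness moves along with its color.
        ... | y , ad , u = transpose b a y , trans (adj-transpose′ v y e) ad , λ z az eq →
          trans (sym (transpose-inverse b a))
            (cong (transpose b a) (u (transpose a b z) (trans (adj-transpose v z e) az) (trans eq (cong D (transpose-inverse a b)))))
        off : ∀ v → Y v ≡ false → D (transpose a b v) ≤ χ
        off v e with v Fin.≟ a
        ... | yes refl = Good.offY g b yb
        ... | no _ with v Fin.≟ b
        ...   | yes refl = Good.offY g a ya
        ...   | no _     = Good.offY g v e

      module _ (K : ℕ) where
        open Marking K

        -- Moves the colors of unmarked vertices to marked ones.  There are K marked
        -- vertices of the type of a, so one of them has color 0 and is not in Y, and
        -- swapping it with a changes no neighborhood of a vertex of Y.
        settle : ∀ pending settled D → Good D →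
                 (∀ v → D v ≢ 0 → v ∈ elements Y ⊎ v ∈ pending ⊎ v ∈ settled) →
                 (∀ {v} → v ∈ settled → mark τ Y v ≡ true) →
                 length (elements Y) + (length pending + length settled) < K →
                 ∃[ D′ ] Good D′ × (∀ v → mark τ Y v ≡ false → D′ v ≡ 0)
        settle [] settled D g sup ms l = D , g , unmarked
          where
          unmarked : ∀ v → mark τ Y v ≡ false → D v ≡ 0
          unmarked v e with D v ≟ 0
          ... | yes z = z
          ... | no nz with sup v nz
          ...   | inj₁ m        = contradiction (trans (sym e) (mark-Y τ Y v (∈-elements⁻ Y m))) λ ()
          ...   | inj₂ (inj₂ m) = contradiction (trans (sym e) (ms m)) λ ()
        settle (a ∷ pending) settled D g sup ms l with mark τ Y a in ma | D a ≟ 0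
        ... | true | _ = settle pending (a ∷ settled) D g
          (λ v nz → move (sup v nz)) (λ { (here refl) → ma ; (there m) → ms m })
          (subst (λ z → length (elements Y) + z < K) (sym (+-suc (length pending) (length settled))) l)
          where
          move : ∀ {v} → v ∈ elements Y ⊎ v ∈ (a ∷ pending) ⊎ v ∈ settled → v ∈ elements Y ⊎ v ∈ pending ⊎ v ∈ (a ∷ settled)
          move (inj₁ m)                  = inj₁ m
          move (inj₂ (inj₁ (here refl))) = inj₂ (inj₂ (here refl))
          move (inj₂ (inj₁ (there m)))   = inj₂ (inj₁ m)
          move (inj₂ (inj₂ m))           = inj₂ (inj₂ (there m))
        ... | false | yes z = settle pending settled D g
          (λ v nz → drop v nz (sup v nz)) ms (≤-trans (s≤s (+-monoʳ-≤ (length (elements Y)) (n≤1+n _))) l)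
          where
          drop : ∀ v → D v ≢ 0 → v ∈ elements Y ⊎ v ∈ (a ∷ pending) ⊎ v ∈ settled → v ∈ elements Y ⊎ v ∈ pending ⊎ v ∈ settled
          drop v nz (inj₁ m)                  = inj₁ m
          drop v nz (inj₂ (inj₁ (here refl))) = contradiction z nz
          drop v nz (inj₂ (inj₁ (there m)))   = inj₂ (inj₁ m)
          drop v nz (inj₂ (inj₂ m))           = inj₂ (inj₂ m)
        -- All nonzero colors lie on these three lists, whose total length never grows and stays
        -- below `K`; a marked vertex off the lists has color 0.
        ... | false | no Da≢0 with pigeonhole (λ i → mark τ Y i ∧ (τ i == τ a)) (elements Y ++ (a ∷ pending) ++ settled)
            (<-≤-trans (subst (_< K) (sym lengths) l) (many-representatives τ Y a ma))
          where
          lengths : length (elements Y ++ (a ∷ pending) ++ settled) ≡ length (elements Y) + (length (a ∷ pending) + length settled)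
          lengths = trans (length-++ (elements Y)) (cong (length (elements Y) +_) (length-++ (a ∷ pending)))
        ...   | b , e , b∉ with ∧-true⁻ {mark τ Y b} e
        ...     | mb , tb = settle pending (b ∷ settled) (D ∘ transpose a b)
          (swap-good a b ya yb (==⇒≡ (τ b) (τ a) tb) g) sup′
          (λ { (here refl) → mb ; (there m) → ms m })
          (subst (λ z → length (elements Y) + z < K) (sym (+-suc (length pending) (length settled))) l)
          where
          ya : Y a ≡ false
          ya = ¬true⇒false λ y → contradiction (trans (sym ma) (mark-Y τ Y a y)) λ ()
          yb : Y b ≡ false
          yb = ¬true⇒false λ y → b∉ (∈-++⁺ˡ (∈-elements⁺ Y b y))
          b-zero : D b ≡ 0
          b-zero with D b ≟ 0
          ... | yes z = z
          ... | no nz with sup b nz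
          ...   | inj₁ m        = contradiction (∈-++⁺ˡ m) b∉
          ...   | inj₂ (inj₁ m) = contradiction (∈-++⁺ʳ (elements Y) (∈-++⁺ˡ m)) b∉
          ...   | inj₂ (inj₂ m) = contradiction (∈-++⁺ʳ (elements Y) (∈-++⁺ʳ (a ∷ pending) m)) b∉
          sup′ : ∀ v → D (transpose a b v) ≢ 0 → v ∈ elements Y ⊎ v ∈ pending ⊎ v ∈ (b ∷ settled)
          sup′ v nz with v Fin.≟ a
          ... | yes refl = contradiction b-zero nz
          ... | no v≢a with v Fin.≟ b
          ...   | yes refl = inj₂ (inj₂ (here refl))
          ...   | no _ with sup v nz
          ...     | inj₁ m                  = inj₁ m
          ...     | inj₂ (inj₁ (here refl)) = contradiction refl v≢a
          ...     | inj₂ (inj₁ (there m))   = inj₂ (inj₁ m)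
          ...     | inj₂ (inj₂ m)           = inj₂ (inj₂ (there m))

        marked-coloring : cnt Y + cnt Y < K →
                          ∃[ D ] Valid G D × (∀ v → D v ≤ suc χ) × (∀ v → mark τ Y v ≡ false → D v ≡ 0)
        marked-coloring l with settle (map representative (elements Y)) [] start start-good
          (λ v nz → weaken (start-support v nz)) (λ ())
          (subst (_< K) (sym (cong₂ _+_ (length-elements Y) (trans (+-identityʳ _) (trans (length-map representative (elements Y)) (length-elements Y))))) l)
          where
          weaken : ∀ {A B C : Set} → A ⊎ B → A ⊎ B ⊎ C
          weaken (inj₁ a) = inj₁ a
          weaken (inj₂ b) = inj₂ (inj₁ b)
        ... | D , g , z = D , good⇒valid g , good-bound g , z

  Colorable : ℕ → Set
  Colorable k = ∃[ C ] Valid G C × (∀ v → C v < k)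

  -- Exhaustive search by the algorithm's own candidate lists with every vertex marked. Decidability
  -- is what makes the minimum χ available constructively.
  colorable? : ∀ k → 0 < n → Dec (Colorable k)
  colorable? zero    (s≤s _) = no λ { (C , _ , b) → contradiction (b zero) λ () }
  colorable? (suc k) _ = map′ to from (any? (λ s → check s (rows G) Bool.≟ true) ss)
    where
    ms = tabulate {n = n} (const true)
    ss = cands (downFrom (suc k)) ms
    to : Any (λ s → check s (rows G) ≡ true) ss → Colorable (suc k)
    to a with find a
    ... | s , m , e with tabulate-exists {n = n} s (trans (sym (Pointwise.Pointwise-length (∈-cands⁻ ms m))) (length-tabulate {n = n} (const true)))
    ...   | C , refl = C , check⇒valid G C e , λ v → s≤s (tabulate⁻ (cands-bounded ms m) v)
    from : Colorable (suc k) → Any (λ s → check s (rows G) ≡ true) ss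
    from (C , V , b) = lose (∈-cands⁺ ms (Pointwise.tabulate⁺ λ v → s≤s⁻¹ (b v) , λ ())) (valid⇒check G C V)

least : ∀ {P : ℕ → Set} → (∀ k → Dec (P k)) → ∀ m → P m → ∃[ k ] P k × (∀ j → P j → k ≤ j)
least P? zero p = 0 , p , λ _ _ → z≤n
least {P} P? (suc m) p with P? 0
... | yes p0 = 0 , p0 , λ _ _ → z≤n
... | no ¬p0 with least (P? ∘ suc) m p
...   | k , pk , min = suc k , pk , λ { zero p0 → contradiction p0 ¬p0 ; (suc j) pj → s≤s (min j pj) }

-- The parameter-dependent factor

-- The input is a bare pair, not an environment: its tail is the set itself, which becomes `var 1`
-- only by repackaging.
algₑ : Exp
algₑ = searchₑ · (var 0 ∷ₑ tlₑ env ∷ₑ nilₑ)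

addₑ mulₑ powₑ : Exp
addₑ = foldₑ (var 0) (var 1) (nilₑ ∷ₑ var 1)
mulₑ = foldₑ (var 0) nilₑ (addₑ · (var 3 ∷ₑ var 1 ∷ₑ nilₑ))
powₑ = foldₑ (var 1) (natₑ 1) (mulₑ · (var 2 ∷ₑ var 1 ∷ₑ nilₑ))

-- With |X| = d and |Y| ≤ d + 1: the budget, a bound |Y| + 2^|Y| · budget for the number of marked
-- vertices, and the resulting bound for the number of candidates.
colors markBound scale : ℕ → ℕ
colors d    = 4 + (d + d)
markBound d = suc d + 2 ^ suc d * colors d
scale d     = suc (colors d) ^ markBound d

factorₑ : ℕ → Exp
factorₑ e = letₑ (addₑ · (natₑ 4 ∷ₑ addₑ · (hdₑ env ∷ₑ hdₑ env ∷ₑ nilₑ) ∷ₑ nilₑ))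
  (powₑ · (powₑ · ((nilₑ ∷ₑ var 0) ∷ₑ
      addₑ · ((nilₑ ∷ₑ var 1) ∷ₑ mulₑ · (powₑ · (natₑ 2 ∷ₑ (nilₑ ∷ₑ var 1) ∷ₑ nilₑ) ∷ₑ var 0 ∷ₑ nilₑ) ∷ₑ nilₑ) ∷ₑ nilₑ)
    ∷ₑ natₑ e ∷ₑ nilₑ))

module _ where
  open Run ⊥ 0 ⊥-elim

  run-add : ∀ a b → addₑ ∶ encℕ a ∙ encℕ b ∙ nil ⇒ encℕ (a + b)
  run-add a b = run-times (λ j → encℕ (j + b)) a ⊥-elim (run-var 0) (run-var 1) λ j → run-nil ⟨∷⟩ run-var 1

  run-mul : ∀ a b → mulₑ ∶ encℕ a ∙ encℕ b ∙ nil ⇒ encℕ (a * b)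
  run-mul a b = run-times (λ j → encℕ (j * b)) a ⊥-elim (run-var 0) run-nil λ j →
    run-call (run-var 3 ⟨∷⟩ run-var 1 ⟨∷⟩ run-nil) (run-add b (j * b))

  run-pow : ∀ a b → powₑ ∶ encℕ a ∙ encℕ b ∙ nil ⇒ encℕ (a ^ b)
  run-pow a b = run-times (λ j → encℕ (a ^ j)) b ⊥-elim (run-var 1) (run-natₑ 1) λ j →
    run-call (run-var 2 ⟨∷⟩ run-var 1 ⟨∷⟩ run-nil) (run-mul a (a ^ j))

  run-factor : ∀ e d → factorₑ e ∶ encℕ d ∙ nil ⇒ encℕ (scale d ^ e)
  run-factor e d =
    run-let (run-call (run-natₑ 4 ⟨∷⟩ run-call (run-hd run-env ⟨∷⟩ run-hd run-env ⟨∷⟩ run-nil) (run-add d d) ⟨∷⟩ run-nil) (run-add 4 (d + d)))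
      (run-call (run-call ((run-nil ⟨∷⟩ run-var 0) ⟨∷⟩
          run-call ((run-nil ⟨∷⟩ run-var 1) ⟨∷⟩
            run-call (run-call (run-natₑ 2 ⟨∷⟩ (run-nil ⟨∷⟩ run-var 1) ⟨∷⟩ run-nil) (run-pow 2 (suc d)) ⟨∷⟩ run-var 0 ⟨∷⟩ run-nil)
              (run-mul (2 ^ suc d) (colors d)) ⟨∷⟩ run-nil)
            (run-add (suc d) (2 ^ suc d * colors d)) ⟨∷⟩ run-nil)
          (run-pow (suc (colors d)) (markBound d)) ⟨∷⟩ run-natₑ e ⟨∷⟩ run-nil)
        (run-pow (scale d) e))

  computable-factor : ∀ e → Computable (λ d → scale d ^ e)
  computable-factor e = ⟪ factorₑ e · (env ∷ₑ nilₑ) ⟫ , λ d →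
    let r = run-call (run-env ⟨∷⟩ run-nil) (run-factor e d) in _∶_⇒_.time r , _∶_⇒_.derivation r

-- Encodings and the running time

^-distribʳ-* : ∀ m n e → (m * n) ^ e ≡ m ^ e * n ^ e
^-distribʳ-* m n zero    = refl
^-distribʳ-* m n (suc e) = trans (cong (m * n *_) (^-distribʳ-* m n e)) ([m*n]*[o*p]≡[m*o]*[n*p] m n (m ^ e) (n ^ e))

toList-tabulate : ∀ {A : Set} {n} (g : Fin n → A) → Vec.toList (Vec.tabulate g) ≡ tabulate g
toList-tabulate {n = zero}  g = refl
toList-tabulate {n = suc n} g = cong (g zero ∷_) (toList-tabulate (g ∘ suc))

toList-lookup : ∀ {n} (X : Subset n) → Vec.toList X ≡ tabulate (Vec.lookup X)
toList-lookup Vec.[]      = refl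
toList-lookup (x Vec.∷ X) = cong (x ∷_) (toList-lookup X)

∣∣≡cnt : ∀ {n} (X : Subset n) → ∣ X ∣ ≡ cnt (Vec.lookup X)
∣∣≡cnt Vec.[]            = refl
∣∣≡cnt (inside  Vec.∷ X) = cong suc (∣∣≡cnt X)
∣∣≡cnt (outside Vec.∷ X) = ∣∣≡cnt X

encGraph-rows : ∀ {n} (G : Graph n) → encGraph G ≡ encList bits (rows G)
encGraph-rows {n} G = trans (cong (encList encSubset) (toList-tabulate (N G))) (rowwise (Graph.adj G))
  where
  rowwise : ∀ {m} (a : Fin m → Fin n → Bool) →
            encList encSubset (tabulate λ v → Vec.tabulate (a v)) ≡ encList bits (tabulate λ v → tabulate (a v))
  rowwise {zero}  a = refl
  rowwise {suc m} a = cong₂ _∙_ (cong bits (toList-tabulate (a zero))) (rowwise (a ∘ suc))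

budget-tabulate : ∀ {n} (x : Fin n → Bool) → budget (tabulate x) ≡ colors (cnt x)
budget-tabulate x = go x 4
  where
  go : ∀ {n} (x : Fin n → Bool) j → foldl (λ j x → when x then 2 + j else j) j (tabulate x) ≡ j + (cnt x + cnt x)
  go {zero}  x j = sym (+-identityʳ j)
  go {suc n} x j with x zero
  ... | false = go (x ∘ suc) j
  ... | true  = trans (go (x ∘ suc) (2 + j)) (trans (cong suc (sym (+-suc j _)))
                  (trans (sym (+-suc j _)) (cong (λ z → j + suc z) (sym (+-suc (cnt (x ∘ suc)) (cnt (x ∘ suc)))))))

length-cands : ∀ {n} c cs (m : Fin n → Bool) → length (cands (c ∷ cs) (tabulate m)) ≡ length (c ∷ cs) ^ cnt m
length-cands {zero}  c cs m = refl
length-cands {suc n} c cs m with m zero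
... | true  = trans (length-ext (c ∷ cs) (cands (c ∷ cs) (tabulate (m ∘ suc)))) (cong (length (c ∷ cs) *_) (length-cands c cs (m ∘ suc)))
... | false = trans (length-ext (0 ∷ []) (cands (c ∷ cs) (tabulate (m ∘ suc)))) (trans (*-identityˡ _) (length-cands c cs (m ∘ suc)))

module _ {n} (G : Graph n) (X : Subset n) where

  private
    x = Vec.lookup X
    d = cnt x
    K = budget (tabulate x)
    -- A product bounds both the lists of vertices, by `n`, and the lists of candidates, by
    -- `scale d`; its powers separate the two variables.
    S = scale d * n

  cands-small : ∀ {Y k} → Y ∈ plants (tabulate x) → k ≤ K → length (cands (downFrom (suc k)) (marks (rows G) Y K)) ≤ scale d
  cands-small {k = k} m k≤K with ∈plants⇒plant x m
  ... | u , refl rewrite Marking.typesAndMarks-tabulate K (tabulate (plant x u)) (λ v → tabulate (Graph.adj G v)) (plant x u) = begin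
    length (cands (downFrom (suc k)) (tabulate mk))   ≡⟨ length-cands k (downFrom k) mk ⟩
    length (downFrom (suc k)) ^ cnt mk                ≡⟨ cong (_^ cnt mk) (length-downFrom (suc k)) ⟩
    suc k ^ cnt mk                                    ≤⟨ ^-monoˡ-≤ (cnt mk) (s≤s k≤K) ⟩
    suc K ^ cnt mk                                    ≤⟨ ^-monoʳ-≤ (suc K) (Marking.few-marked K (Graph.adj G) Y) ⟩
    suc K ^ (cnt Y + 2 ^ cnt Y * K)                   ≤⟨ ^-monoʳ-≤ (suc K) (+-mono-≤ (cnt-plant x u) (*-monoˡ-≤ K (^-monoʳ-≤ 2 (cnt-plant x u)))) ⟩
    suc K ^ (suc d + 2 ^ suc d * K)                   ≡⟨ cong (λ K → suc K ^ (suc d + 2 ^ suc d * K)) (budget-tabulate x) ⟩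
    scale d                                           ∎
    where
    open ≤-Reasoning
    Y = plant x u
    mk = Marking.mark K (λ v → typ (tabulate (Graph.adj G v)) (tabulate Y)) Y

  module _ (2≤n : 2 ≤ n) where

    instance
      n-nonZero : NonZero n
      n-nonZero = >-nonZero (≤-trans (s≤s z≤n) 2≤n)

    K<scale : suc K ≤ scale d
    K<scale = begin
      suc K                       ≡⟨ cong suc (budget-tabulate x) ⟩
      suc (colors d)              ≡⟨ sym (^-identityʳ _) ⟩
      suc (colors d) ^ 1          ≤⟨ ^-monoʳ-≤ (suc (colors d)) {1} {markBound d} (s≤s z≤n) ⟩
      scale d                     ∎
      where open ≤-Reasoning

    scale≤S : scale d ≤ S
    scale≤S = m≤m*n (scale d) n

    K<S : suc K ≤ S
    K<S = ≤-trans K<scale scale≤S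

    4≤S : 4 ≤ S
    4≤S = ≤-trans (≤-trans (m≤m+n 4 (d + d)) (≤-trans (≤-reflexive (sym (budget-tabulate x))) (n≤1+n K))) K<S

    n≤S : n ≤ S
    n≤S = m≤n*m n (scale d) {{>-nonZero (≤-trans (s≤s z≤n) K<scale)}}

    open Run ⊤ S (const 4≤S)

    run-alg : algₑ ∶ encGraph G ∙ encSubset X ⇒ nats (search (rows G) (tabulate x))
    run-alg rewrite encGraph-rows G | toList-lookup X =
      run-call (run-var 0 ⟨∷⟩ run-tl run-env ⟨∷⟩ run-nil)
        (run-search (rows G) (tabulate x) (λ _ → subst (_≤ S) (sym (length-tabulate x)) n≤S)
          (trans (length-tabulate {n = n} _) (sym (length-tabulate x)))
          (tabulate⁺ λ v → trans (length-tabulate (Graph.adj G v)) (sym (length-tabulate x)))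
          (const K<S) (λ m k≤K _ → ≤-trans (cands-small m k≤K) scale≤S))

    run-alg-time : ∃[ t ] (⟪ algₑ ⟫ ⊢ encGraph G ∙ encSubset X ⇓ nats (search (rows G) (tabulate x)) [ t ]) ×
                   t ≤ scale d ^ expo algₑ * n ^ expo algₑ
    run-alg-time = time , derivation , ≤-trans (within tt) (≤-reflexive (^-distribʳ-* (scale d) n (expo algₑ)))
      where open _∶_⇒_ run-alg

-- The approximation guarantee

valid-cong : ∀ {n} (G : Graph n) {C D : Fin n → ℕ} → C ≗ D → Valid G C → Valid G D
valid-cong G h V v with V v
... | y , a , u = y , a , λ z az e → u z az (trans (h z) (trans e (sym (h y))))

colorable⇒CFON : ∀ {n k} (G : Graph n) (C : Fin n → ℕ) → Valid G C → (b : ∀ v → C v < k) → IsCFON G (λ v → fromℕ< (b v))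
colorable⇒CFON G C V b = valid⇒CFON G _ (valid-cong G (λ v → sym (Fin.toℕ-fromℕ< (b v))) V)

cnt-plant-twice : ∀ {n} (x : Fin n → Bool) u → cnt (plant x u) + cnt (plant x u) ≤ 2 + (cnt x + cnt x)
cnt-plant-twice x u =
  ≤-trans (+-mono-≤ (cnt-plant x u) (cnt-plant x u)) (≤-reflexive (cong suc (+-suc (cnt x) (cnt x))))

search-approximates : ∀ {n} (G : Graph n) (X : Subset n) → 2 ≤ n → Connected G → Threshold (G ∖ X) →
                      ∃[ χ ] (χcf[ G ]≡ χ) × Found G (suc χ) (search (rows G) (tabulate (Vec.lookup X)))
search-approximates G X 2≤n conn T with threshold-modulator G X 2≤n conn T
... | u , M with few-colors-suffice G M
...   | C₀ , V₀ , b₀ with least (λ k → colorable? G k (≤-trans (s≤s z≤n) 2≤n)) _ (C₀ , V₀ , λ v → s≤s (b₀ v))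
...     | χ , (C , V , b) , min with marked-coloring G M C V b (budget (tabulate (Vec.lookup X))) few
  where
  x = Vec.lookup X
  -- Nonzero colors sit on |Y| vertices of Y and at most |Y| representatives; with d = |X|, this is
  -- at most 2d + 2 < 2d + 4.
  few : cnt (plant x u) + cnt (plant x u) < budget (tabulate x)
  few = subst (cnt (plant x u) + cnt (plant x u) <_) (sym (budget-tabulate x)) (≤-trans (s≤s (cnt-plant-twice x u)) (n≤1+n _))
...       | D , VD , bD , zD =
  χ , (((λ v → fromℕ< (b v)) , colorable⇒CFON G C V b) ,
       λ k (F , cf) → min k (toℕ ∘ F , CFON⇒valid G F cf , λ v → Fin.toℕ<n (F v))) ,
  search-found G x u D level≤ VD bD zD
  where
  x = Vec.lookup X
  -- With d = |X|, χ ≤ 2|Y| + 1 ≤ 2d + 3, so level `suc χ` is at most 2d + 4: this is the origin of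
  -- the 4 in `budget`.
  level≤ : suc χ ≤ budget (tabulate x)
  level≤ = subst (suc χ ≤_) (sym (budget-tabulate x))
    (s≤s (≤-trans (min _ (C₀ , V₀ , λ v → s≤s (b₀ v))) (s≤s (cnt-plant-twice x u))))

-- The number k is taken to be χ + 2 in the proof alone. The output has colors at most χ + 1, so it
-- can be read as a coloring with χ + 2 colors even if it uses fewer.
approximation : ∀ alg e →
  (∀ {n} (G : Graph n) (X : Subset n) → 2 ≤ n →
   ∃[ t ] (alg ⊢ encGraph G ∙ encSubset X ⇓ nats (search (rows G) (tabulate (Vec.lookup X))) [ t ]) ×
          t ≤ scale (cnt (Vec.lookup X)) ^ e * n ^ e) →
  ∀ n d (G : Graph n) (X : Subset n) → 2 ≤ n → Connected G → ∣ X ∣ ≡ d → Threshold (G ∖ X) →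
  ∃[ k ] Σ (Coloring n k) λ C → ∃[ t ] (alg ⊢ encGraph G ∙ encSubset X ⇓ encColoring C [ t ]) ×
  t ≤ scale d ^ e * n ^ e × IsCFON G C × (∃[ χ ] (χcf[ G ]≡ χ) × χ ≤ k × k ≤ χ + 2)
approximation alg e evaluate n .(∣ X ∣) G X 2≤n conn refl T with search-approximates G X 2≤n conn T | evaluate G X 2≤n
... | χ , isχ , E , out , V , b | t , evaluation , t≤ =
  suc (suc χ) , (λ v → fromℕ< (s≤s (b v))) , t ,
  subst (λ z → alg ⊢ encGraph G ∙ encSubset X ⇓ z [ t ])
    (cong nats (trans out (trans (tabulate-cong λ v → sym (Fin.toℕ-fromℕ< (s≤s (b v)))) (sym (toList-tabulate _))))) evaluation ,
  subst (λ z → t ≤ scale z ^ e * n ^ e) (sym (∣∣≡cnt X)) t≤ ,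
  colorable⇒CFON G E V (λ v → s≤s (b v)) ,
  χ , isχ , ≤-trans (n≤1+n χ) (n≤1+n _) , ≤-reflexive (+-comm 2 χ)

corollary1 :
    Σ (ℕ → ℕ) λ f → Computable f ×
    (Σ Prog λ alg → Σ ℕ λ e →
      ∀ (n d : ℕ) (G : Graph n) (X : Subset n) →
      2 ≤ n → Connected G → ∣ X ∣ ≡ d → Threshold (G ∖ X) →
      Σ ℕ λ k → Σ (Coloring n k) λ C → Σ ℕ λ t →
        (alg ⊢ encGraph G ∙ encSubset X ⇓ encColoring C [ t ]) ×
        t ≤ f d * n ^ e ×
        IsCFON G C ×
        (Σ ℕ λ χ → (χcf[ G ]≡ χ) × χ ≤ k × k ≤ χ + 2))
corollary1 = (λ d → scale d ^ expo algₑ) , computable-factor (expo algₑ) , ⟪ algₑ ⟫ , expo algₑ ,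
  approximation ⟪ algₑ ⟫ (expo algₑ) run-alg-time
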